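{- Let $t\in\mathbb{N}$ and let $\mathscr D$ be a graph class of structurally bounded expansion such that no member of $\mathscr D$ contains $K_{t,t}$ as an induced subgraph. Then $\mathscr D$ has bounded subchromatic number.
   Context: Graphs are finite, simple, undirected. A (first-order) transduction $\mathsf T$ consists of a finite set $C$ of unary predicates and a symmetric first-order formula $\varphi(x,y)$ over graphs expanded by the predicates of $C$. A graph $H$ is transducible from $G$ via $\mathsf T$ if $H$ is obtained by: choosing arbitrary interpretations of the predicates of $C$ as vertex subsets of $G$ (obtaining $G^+$); forming the graph $H^+$ on $V(G)$ in which $u,v$ are adjacent iff $G^+\models\varphi(u,v)$; and taking an arbitrary induced subgraph of $H^+$. A class $\mathscr D$ is transducible from $\mathscr C$ if there is a transduction $\mathsf T$ such that every member of $\mathscr D$ is transducible via $\mathsf T$ from some member of $\mathscr C$. A graph $H$ is a depth-$d$ minor of $G$ if one can assign to each $u\in V(H)$ a connected subgraph $\eta(u)$ of $G$ of radius at most $d$, pairwise vertex-disjoint, with an edge of $G$ between $\eta(u)$ and $\eta(v)$ for each edge $uv$ of $H$; a class has bounded expansion if for each $d$ the maximum average degree of depth-$d$ minors of its members is bounded. $\mathscr D$ has structurally bounded expansion if it is transducible from some class of bounded expansion. A cluster graph is a graph whose every component is a clique; a subcoloring of $G$ is a map $\lambda\colon V(G)\to C$ with $G[\lambda^{ -1}(i)]$ a cluster graph for each $i$; the subchromatic number is the minimum number of colors of a subcoloring; a class has bounded subchromatic number if some constant bounds it for all members. -}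

module Defs where

open import Data.Nat using (ℕ; zero; suc; _+_; _*_; _≤_; _<_)
open import Data.Nat.Properties using (_<?_)
open import Data.Fin using (Fin; zero; suc; toℕ; _≟_)
open import Data.Nat.Base as ℕ using ()
open import Data.Bool using (Bool; true; false; _∧_; _∨_; not; if_then_else_; _xor_)
open import Data.Maybe using (Maybe; just; nothing)
open import Data.Product using (Σ; ∃; ∃-syntax; _×_; _,_)
open import Relation.Nullary using (¬_)
open import Relation.Nullary.Decidable using (⌊_⌋)
open import Relation.Binary.PropositionalEquality using (_≡_; _≢_; refl)
open import Function.Definitions using (Injective)

record Graph : Set where
  field
    n     : ℕ
    adj   : Fin n → Fin n → Bool
    sym   : ∀ u v → adj u v ≡ adj v u
    irr   : ∀ u → adj u u ≡ false
open Graph public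

GraphClass : Set₁
GraphClass = Graph → Set

InducedSubgraph : Graph → Graph → Set
InducedSubgraph H G =
  Σ (Fin (n H) → Fin (n G)) λ f →
    Injective _≡_ _≡_ f × (∀ u v → adj H u v ≡ adj G (f u) (f v))

side : {t : ℕ} → Fin (t + t) → Bool
side {t} u = ⌊ toℕ u <? t ⌋

xor-comm' : ∀ a b → a xor b ≡ b xor a
xor-comm' true true = refl
xor-comm' true false = refl
xor-comm' false true = refl
xor-comm' false false = refl

xor-self : ∀ a → a xor a ≡ false
xor-self true = refl
xor-self false = refl

K : ℕ → Graph
K t = record
  { n   = t + t
  ; adj = λ u v → side {t} u xor side {t} v
  ; sym = λ u v → xor-comm' (side {t} u) (side {t} v)
  ; irr = λ u → xor-self (side {t} u)
  }

data Formula (k : ℕ) : ℕ → Set where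
  edge  : ∀ {m} → Fin m → Fin m → Formula k m
  equal : ∀ {m} → Fin m → Fin m → Formula k m
  pred  : ∀ {m} → Fin k → Fin m → Formula k m
  neg   : ∀ {m} → Formula k m → Formula k m
  conj  : ∀ {m} → Formula k m → Formula k m → Formula k m
  disj  : ∀ {m} → Formula k m → Formula k m → Formula k m
  ex    : ∀ {m} → Formula k (ℕ.suc m) → Formula k m      -- ∃ (binds variable zero)
  all   : ∀ {m} → Formula k (ℕ.suc m) → Formula k m      -- ∀ (binds variable zero)

anyFin : ∀ {n} → (Fin n → Bool) → Bool
anyFin {zero}  f = false
anyFin {ℕ.suc n} f = f zero ∨ anyFin (λ i → f (suc i))

allFin : ∀ {n} → (Fin n → Bool) → Bool
allFin {zero}  f = true
allFin {ℕ.suc n} f = f zero ∧ allFin (λ i → f (suc i))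

extend : ∀ {m} {A : Set} → A → (Fin m → A) → Fin (ℕ.suc m) → A
extend a ρ zero    = a
extend a ρ (suc i) = ρ i

eval : ∀ {k m} (G : Graph) → (Fin k → Fin (n G) → Bool) →
       Formula k m → (Fin m → Fin (n G)) → Bool
eval G P (edge x y)  ρ = adj G (ρ x) (ρ y)
eval G P (equal x y) ρ = ⌊ ρ x ≟ ρ y ⌋
eval G P (pred c x)  ρ = P c (ρ x)
eval G P (neg φ)     ρ = not (eval G P φ ρ)
eval G P (conj φ ψ)  ρ = eval G P φ ρ ∧ eval G P ψ ρ
eval G P (disj φ ψ)  ρ = eval G P φ ρ ∨ eval G P ψ ρ
eval G P (ex φ)      ρ = anyFin (λ v → eval G P φ (extend v ρ))
eval G P (all φ)     ρ = allFin (λ v → eval G P φ (extend v ρ))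

pair : ∀ {A : Set} → A → A → Fin 2 → A
pair a b zero    = a
pair a b (suc _) = b

record Transduction : Set where
  field
    k         : ℕ
    φ         : Formula k 2
    symmetric : ∀ (G : Graph) (P : Fin k → Fin (n G) → Bool) (u v : Fin (n G)) →
                eval G P φ (pair u v) ≡ eval G P φ (pair v u)
open Transduction public

-- H⁺ : the graph on V(G) with u ~ v iff G⁺ ⊨ φ(u,v)  (u ≠ v, simple graph).
-- (φ is symmetric, so the conjunction with φ(v,u) changes nothing.)
interpret : (T : Transduction) (G : Graph) → (Fin (k T) → Fin (n G) → Bool) → Graph
interpret T G P = record
  { n   = n G
  ; adj = λ u v → not ⌊ u ≟ v ⌋ ∧ (eval G P (φ T) (pair u v) ∧ eval G P (φ T) (pair v u))
  ; sym = λ u v → symproof u v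
  ; irr = λ u → irrproof u
  }
  where
  open import Data.Bool.Properties using (∧-comm)
  open import Relation.Binary.PropositionalEquality using (refl; cong; cong₂)
  open import Relation.Nullary using (yes; no)
  open import Relation.Binary.PropositionalEquality renaming (sym to ≡sym) using ()
  f = λ u v → eval G P (φ T) (pair u v)
  eqb : ∀ (u v : Fin (n G)) → ⌊ u ≟ v ⌋ ≡ ⌊ v ≟ u ⌋
  eqb u v with u ≟ v | v ≟ u
  ... | yes _ | yes _ = refl
  ... | no _  | no _  = refl
  ... | yes p | no q  = Data.Empty.⊥-elim (q (≡sym p)) where import Data.Empty
  ... | no p  | yes q = Data.Empty.⊥-elim (p (≡sym q)) where import Data.Empty
  symproof : ∀ u v → (not ⌊ u ≟ v ⌋ ∧ (f u v ∧ f v u)) ≡ (not ⌊ v ≟ u ⌋ ∧ (f v u ∧ f u v))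
  symproof u v = cong₂ _∧_ (cong not (eqb u v)) (∧-comm (f u v) (f v u))
  irrproof : ∀ u → (not ⌊ u ≟ u ⌋ ∧ (f u u ∧ f u u)) ≡ false
  irrproof u with u ≟ u
  ... | yes _ = refl
  ... | no ¬p = Data.Empty.⊥-elim (¬p refl) where import Data.Empty

TransducibleVia : Transduction → Graph → Graph → Set
TransducibleVia T G H =
  Σ (Fin (k T) → Fin (n G) → Bool) λ P → InducedSubgraph H (interpret T G P)

ClassTransducible : GraphClass → GraphClass → Set
ClassTransducible 𝒞 𝒟 =
  Σ Transduction λ T → ∀ H → 𝒟 H → Σ Graph λ G → 𝒞 G × TransducibleVia T G H

data WalkIn (G : Graph) (S : Fin (n G) → Bool) : Fin (n G) → Fin (n G) → ℕ → Set where
  here : ∀ {x} → S x ≡ true → WalkIn G S x x 0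
  step : ∀ {x z y l} → S x ≡ true → adj G x z ≡ true →
         WalkIn G S z y l → WalkIn G S x y (ℕ.suc l)

-- Depth-d minors.  β x = just u means x ∈ η(u) (so branch sets are
-- pairwise disjoint); c u is a centre of η(u); every vertex of η(u) is
-- reachable from c u by a walk in η(u) of length ≤ d (so η(u) is
-- connected of radius ≤ d).

isBranch : (G H : Graph) → (Fin (n G) → Maybe (Fin (n H))) → Fin (n H) → Fin (n G) → Bool
isBranch G H β u x with β x
... | nothing = false
... | just w  = ⌊ w ≟ u ⌋

DepthMinor : ℕ → Graph → Graph → Set
DepthMinor d H G =
  Σ (Fin (n G) → Maybe (Fin (n H))) λ β →
  Σ (Fin (n H) → Fin (n G)) λ c →
    (∀ u → β (c u) ≡ just u)
  × (∀ u x → β x ≡ just u →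
       Σ ℕ λ l → l ≤ d × WalkIn G (isBranch G H β u) (c u) x l)
  × (∀ u v → adj H u v ≡ true →
       Σ (Fin (n G)) λ x → Σ (Fin (n G)) λ y →
         β x ≡ just u × β y ≡ just v × adj G x y ≡ true)

sumFin : ∀ {n} → (Fin n → ℕ) → ℕ
sumFin {zero}  f = 0
sumFin {ℕ.suc n} f = f zero + sumFin (λ i → f (suc i))

degreeSum : Graph → ℕ
degreeSum H = sumFin (λ u → sumFin (λ v → if adj H u v then 1 else 0))

-- Bounded expansion: for each d, every depth-d minor H of a member has
-- average degree 2|E(H)|/|V(H)| ≤ f d.
BoundedExpansion : GraphClass → Set
BoundedExpansion 𝒞 =
  Σ (ℕ → ℕ) λ f → ∀ d G → 𝒞 G → ∀ H → DepthMinor d H G →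
    degreeSum H ≤ f d * n H

StructurallyBoundedExpansion : GraphClass → Set₁
StructurallyBoundedExpansion 𝒟 =
  Σ GraphClass λ 𝒞 → BoundedExpansion 𝒞 × ClassTransducible 𝒞 𝒟

IsClusterOn : (G : Graph) → (Fin (n G) → Bool) → Set
IsClusterOn G S = ∀ x y l → WalkIn G S x y l → x ≢ y → adj G x y ≡ true

IsSubcoloring : (G : Graph) {m : ℕ} → (Fin (n G) → Fin m) → Set
IsSubcoloring G {m} λc = ∀ (i : Fin m) → IsClusterOn G (λ x → ⌊ λc x ≟ i ⌋)

BoundedSubchromatic : GraphClass → Set
BoundedSubchromatic 𝒟 =
  Σ ℕ λ m → ∀ G → 𝒟 G → Σ (Fin (n G) → Fin m) λ λc → IsSubcoloring G λc

{-# OPTIONS --safe #-}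

-- Let G be the sparse graph and φ the formula of the transduction.
--
-- 1. G has a vertex ordering in which every vertex weakly l-reaches at most M l vertices, for
--    all l ≤ R, with M independent of R.  The ordering is built from its top end.  If the average
--    number of vertices strongly (l+1)-reachable inside the unranked set were large, let every ranked
--    vertex join at random one of the at most M l unranked vertices that it weakly l-reaches:
--    contracting gives a dense depth-l minor.
--
-- 2. Colour the vertices so that every weak R-reachability set W R x is rainbow, and write w x i for
--    its vertex of colour i.  If w x i ≡ w y i and w x j is ranked below w x i, then w x j is weakly
--    reachable from w x i, hence determined by it and the colour j.  A back-and-forth argument
--    therefore shows that φ(u,v) depends only on bounded types of u and v and on which of the
--    equations w u i ≡ w v i hold: a new vertex y either lies near the tuple, or it branches off
--    from the tuple between two consecutive elements z, z⁺ of its reachability set, and then it is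
--    enough to count the possible z⁺ above z up to a threshold.
--
-- 3. Among vertices of one type, the sets { i : w u i ≡ w v i } form a chain under inclusion, so their
--    size is the depth of the least common ancestor in a tree of bounded height and decides adjacency:
--    every type induces a cograph of bounded height.  At a join node at most one child contains an
--    independent t-set, since two would give K t; below a node without an independent t-set, every
--    union node has fewer than t children.  Colouring each vertex by its type and, for every node on
--    its branch, by the presence of an independent t-set and the position among the siblings gives
--    a subcolouring.
module Submission where

open import Defs
open import Data.Bool using (Bool; true; false; not; _∧_; _∨_; _xor_; if_then_else_)
import Data.Bool.Properties as Boolₚ
open import Data.Empty using (⊥; ⊥-elim)
open import Data.Fin as Fin using (Fin; zero; suc; toℕ; fromℕ<; inject≤; combine; funToFin; finToFun)
open import Data.Fin.Properties using (any?; all?; suc-injective; injective⇒≤; combine-injective; finToFun-funToFin; toℕ-fromℕ<; toℕ<n; toℕ-injective; fromℕ<-injective; inject≤-injective) renaming (_≟_ to _≟ᶠ_)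
open import Data.List as List using (List; []; _∷_; length)
open import Data.List.Membership.Propositional using (_∈_)
import Data.List.Membership.DecPropositional as DecMembership
open import Data.List.Relation.Unary.Any as Any using (here; there)
open import Data.List.Relation.Unary.Any.Properties using (lookup-index)
open import Data.Maybe using (Maybe; just; nothing)
open import Data.Nat using (ℕ; zero; suc; _+_; _*_; _∸_; _^_; _⊓_; _⊔_; _≤_; _<_; z≤n; s≤s; _≤?_; _<?_; >-nonZero)
open import Data.Nat.Properties hiding (suc-injective; _≤?_; _<?_)
open import Data.Nat.Solver using (module +-*-Solver)
open import Data.Product using (Σ; ∃; _×_; _,_; proj₁; proj₂)
open import Data.Sum using (_⊎_; inj₁; inj₂)
open import Function using (_∘_; _⟨_⟩_)
open import Function.Definitions using (Injective)
open import Relation.Binary.Definitions using (Tri; tri<; tri≈; tri>)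
open import Relation.Binary.PropositionalEquality hiding (sym)
open import Relation.Binary.PropositionalEquality using () renaming (sym to ≡sym)
open import Relation.Nullary using (¬_; Dec; yes; no)
open import Relation.Nullary.Decidable using (_×-dec_; _⊎-dec_; _→-dec_; ¬?; map′; ⌊_⌋; decidable-stable)

-- Counting

ind : {A : Set} → Dec A → ℕ
ind (yes _) = 1
ind (no _)  = 0

# : ∀ {n} {P : Fin n → Set} → (∀ x → Dec (P x)) → ℕ
# P? = sumFin (λ x → ind (P? x))

enum : ∀ {n} {P : Fin n → Set} (P? : ∀ x → Dec (P x)) → Fin (# P?) → Fin n
enum {suc n} P? j with P? zero
enum {suc n} P? zero    | yes _ = zero
enum {suc n} P? (suc j) | yes _ = suc (enum (P? ∘ suc) j)
enum {suc n} P? j       | no _  = suc (enum (P? ∘ suc) j)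

enum-∈ : ∀ {n} {P : Fin n → Set} (P? : ∀ x → Dec (P x)) j → P (enum P? j)
enum-∈ {suc n} P? j with P? zero
enum-∈ {suc n} P? zero    | yes p = p
enum-∈ {suc n} P? (suc j) | yes _ = enum-∈ (P? ∘ suc) j
enum-∈ {suc n} P? j       | no _  = enum-∈ (P? ∘ suc) j

enum-injective : ∀ {n} {P : Fin n → Set} (P? : ∀ x → Dec (P x)) → Injective _≡_ _≡_ (enum P?)
enum-injective {suc n} P? {i} {j} eq with P? zero
enum-injective {suc n} P? {zero}  {zero}  eq | yes _ = refl
enum-injective {suc n} P? {suc i} {suc j} eq | yes _ = cong suc (enum-injective (P? ∘ suc) (suc-injective eq))
enum-injective {suc n} P? {i}     {j}     eq | no _  = enum-injective (P? ∘ suc) (suc-injective eq)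

index : ∀ {n} {P : Fin n → Set} (P? : ∀ x → Dec (P x)) x → P x → Fin (# P?)
index {suc n} P? x p with P? zero
index {suc n} P? zero    p | yes _ = zero
index {suc n} P? (suc x) p | yes _ = suc (index (P? ∘ suc) x p)
index {suc n} P? zero    p | no ¬p = ⊥-elim (¬p p)
index {suc n} P? (suc x) p | no _  = index (P? ∘ suc) x p

enum-index : ∀ {n} {P : Fin n → Set} (P? : ∀ x → Dec (P x)) x (p : P x) → enum P? (index P? x p) ≡ x
enum-index {suc n} P? x p with P? zero
enum-index {suc n} P? zero    p | yes _ = refl
enum-index {suc n} P? (suc x) p | yes _ = cong suc (enum-index (P? ∘ suc) x p)
enum-index {suc n} P? zero    p | no ¬p = ⊥-elim (¬p p)
enum-index {suc n} P? (suc x) p | no _  = cong suc (enum-index (P? ∘ suc) x p)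

-- The code may depend on the proof of `P x`, so it can be read off a derivation or a found witness;
-- injectivity concerns the points only.
AtMost : ∀ {n} → ℕ → (Fin n → Set) → Set
AtMost {n} N P = Σ (∀ x → P x → Fin N) λ e → ∀ {x y} p q → e x p ≡ e y q → x ≡ y

atMost⇒#≤ : ∀ {n N} {P : Fin n → Set} (P? : ∀ x → Dec (P x)) → AtMost N P → # P? ≤ N
atMost⇒#≤ P? (e , inj) =
  injective⇒≤ {f = λ j → e (enum P? j) (enum-∈ P? j)} (λ eq → enum-injective P? (inj _ _ eq))

#-atMost : ∀ {n} {P : Fin n → Set} (P? : ∀ x → Dec (P x)) → AtMost (# P?) P
#-atMost P? = index P? , λ {x} {y} p q eq →
  trans (≡sym (enum-index P? x p)) (trans (cong (enum P?) eq) (enum-index P? y q))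

atMost-weaken : ∀ {n N N′} {P : Fin n → Set} → N ≤ N′ → AtMost N P → AtMost N′ P
atMost-weaken le (e , inj) = (λ x p → Fin.inject≤ (e x p) le) ,
  λ p q eq → inj p q (inject≤-injective le le _ _ eq)

#≤⇒atMost : ∀ {n N} {P : Fin n → Set} (P? : ∀ x → Dec (P x)) → # P? ≤ N → AtMost N P
#≤⇒atMost P? le = atMost-weaken le (#-atMost P?)

module _ {n n′} {P : Fin n → Set} {Q : Fin n′ → Set}
         (P? : ∀ x → Dec (P x)) (Q? : ∀ x → Dec (Q x))
         (h : ∀ x → P x → Fin n′) (h-Q : ∀ x p → Q (h x p))
         (h-inj : ∀ {x y} p q → h x p ≡ h y q → x ≡ y) where

  #-injection : # P? ≤ # Q?
  #-injection = atMost⇒#≤ P? ((λ x p → index Q? (h x p) (h-Q x p)) ,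
    λ p q eq → h-inj p q (proj₂ (#-atMost Q?) _ _ eq))

  #-injection-< : ∀ z → Q z → (∀ x p → h x p ≢ z) → # P? < # Q?
  #-injection-< z qz miss = injective⇒≤ {f = g} g-inj
    where
    h′ : Fin (# P?) → Fin n′
    h′ j = h (enum P? j) (enum-∈ P? j)
    g : Fin (suc (# P?)) → Fin (# Q?)
    g zero    = index Q? z qz
    g (suc j) = index Q? (h′ j) (h-Q _ _)
    g-inj : Injective _≡_ _≡_ g
    g-inj {zero}  {zero}  eq = refl
    g-inj {zero}  {suc j} eq = ⊥-elim (miss _ _ (≡sym (proj₂ (#-atMost Q?) qz (h-Q _ _) eq)))
    g-inj {suc i} {zero}  eq = ⊥-elim (miss _ _ (proj₂ (#-atMost Q?) (h-Q _ _) qz eq))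
    g-inj {suc i} {suc j} eq =
      cong suc (enum-injective P? (h-inj _ _ (proj₂ (#-atMost Q?) (h-Q _ _) (h-Q _ _) eq)))

module _ {n} {P Q : Fin n → Set} (P? : ∀ x → Dec (P x)) (Q? : ∀ x → Dec (Q x)) where

  #-mono : (∀ x → P x → Q x) → # P? ≤ # Q?
  #-mono f = #-injection P? Q? (λ x _ → x) f (λ _ _ eq → eq)

  #-mono-< : (∀ x → P x → Q x) → ∀ z → Q z → ¬ P z → # P? < # Q?
  #-mono-< f z qz ¬pz = #-injection-< P? Q? (λ x _ → x) f (λ _ _ eq → eq) z qz λ { x p refl → ¬pz p }

  #-<⇒∃ : # P? < # Q? → ∃ λ x → Q x × ¬ P x
  #-<⇒∃ lt with any? (λ x → Q? x ×-dec ¬? (P? x))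
  ... | yes e = e
  ... | no ¬e = ⊥-elim (<⇒≱ lt (#-injection Q? P? (λ x _ → x)
                  (λ x q → decidable-stable (P? x) λ ¬p → ¬e (x , q , ¬p)) (λ _ _ eq → eq)))

#-cong : ∀ {n} {P Q : Fin n → Set} (P? : ∀ x → Dec (P x)) (Q? : ∀ x → Dec (Q x)) →
         (∀ x → P x → Q x) → (∀ x → Q x → P x) → # P? ≡ # Q?
#-cong P? Q? f g = ≤-antisym (#-mono P? Q? f) (#-mono Q? P? g)

sum-mono : ∀ {n} {f g : Fin n → ℕ} → (∀ i → f i ≤ g i) → sumFin f ≤ sumFin g
sum-mono {zero}  h = z≤n
sum-mono {suc n} h = +-mono-≤ (h zero) (sum-mono (h ∘ suc))

sum-cong : ∀ {n} {f g : Fin n → ℕ} → (∀ i → f i ≡ g i) → sumFin f ≡ sumFin g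
sum-cong {zero}  h = refl
sum-cong {suc n} h = cong₂ _+_ (h zero) (sum-cong (h ∘ suc))

sum-+ : ∀ {n} (f g : Fin n → ℕ) → sumFin (λ i → f i + g i) ≡ sumFin f + sumFin g
sum-+ {zero}  f g = refl
sum-+ {suc n} f g = trans (cong (f zero + g zero +_) (sum-+ (f ∘ suc) (g ∘ suc)))
  (solve 4 (λ a b c d → a :+ b :+ (c :+ d) := a :+ c :+ (b :+ d)) refl (f zero) (g zero) _ _)
  where open +-*-Solver

sum-* : ∀ {n} k (f : Fin n → ℕ) → sumFin (λ i → k * f i) ≡ k * sumFin f
sum-* {zero}  k f = ≡sym (*-zeroʳ k)
sum-* {suc n} k f = trans (cong (k * f zero +_) (sum-* k (f ∘ suc))) (≡sym (*-distribˡ-+ k (f zero) _))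

sum-const : ∀ n k → sumFin {n} (λ _ → k) ≡ n * k
sum-const zero    k = refl
sum-const (suc n) k = cong (k +_) (sum-const n k)

sum-swap : ∀ {a b} (f : Fin a → Fin b → ℕ) →
           sumFin (λ i → sumFin (f i)) ≡ sumFin (λ j → sumFin (λ i → f i j))
sum-swap {zero}  {b} f = ≡sym (trans (sum-const b 0) (*-zeroʳ b))
sum-swap {suc a} f = trans (cong (sumFin (f zero) +_) (sum-swap (f ∘ suc)))
  (≡sym (sum-+ (f zero) _))

sum-∃≥ : ∀ {n} (f : Fin n → ℕ) {k} → 0 < n → n * k ≤ sumFin f → ∃ λ i → k ≤ f i
sum-∃≥ {n} f {zero}  (s≤s _) _ = zero , z≤n
sum-∃≥ {n} f {suc k} 0<n le with any? (λ i → suc k ≤? f i)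
... | yes e = e
... | no ¬e = ⊥-elim (<⇒≱ (*-monoʳ-< n {{>-nonZero 0<n}} (n<1+n k)) (begin
    n * suc k          ≤⟨ le ⟩
    sumFin f           ≤⟨ sum-mono (λ i → ≤-pred (≰⇒> (λ h → ¬e (i , h)))) ⟩
    sumFin {n} (λ _ → k) ≡⟨ sum-const n k ⟩
    n * k              ∎))
  where open ≤-Reasoning

sum-enum : ∀ {n} {P : Fin n → Set} (P? : ∀ x → Dec (P x)) (h : Fin n → ℕ) →
           sumFin (λ x → ind (P? x) * h x) ≡ sumFin (λ j → h (enum P? j))
sum-enum {zero}  P? h = refl
sum-enum {suc n} P? h with P? zero
... | yes _ = cong₂ _+_ (+-identityʳ (h zero)) (sum-enum (P? ∘ suc) (h ∘ suc))
... | no _  = sum-enum (P? ∘ suc) (h ∘ suc)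

#-union : ∀ {n} {P Q T : Fin n → Set} (P? : ∀ x → Dec (P x)) (Q? : ∀ x → Dec (Q x)) (T? : ∀ x → Dec (T x)) →
          (∀ x → P x → Q x ⊎ T x) → # P? ≤ # Q? + # T?
#-union P? Q? T? f = ≤-trans (sum-mono (λ x → aux (P? x) (Q? x) (T? x) (f x))) (≤-reflexive (sum-+ (λ x → ind (Q? x)) (λ x → ind (T? x))))
  where
  aux : ∀ {A B C : Set} (a : Dec A) (b : Dec B) (c : Dec C) → (A → B ⊎ C) → ind a ≤ ind b + ind c
  aux (no _)  _       _       _ = z≤n
  aux (yes _) (yes _) _       _ = s≤s z≤n
  aux (yes _) (no _)  (yes _) _ = s≤s z≤n
  aux (yes a) (no ¬b) (no ¬c) g with g a
  ... | inj₁ b = ⊥-elim (¬b b)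
  ... | inj₂ c = ⊥-elim (¬c c)

module _ {n} (μ : Fin n → ℕ) where

  argmin : ∀ {P : Fin n → Set} (P? : ∀ x → Dec (P x)) → ∀ {x} → P x →
           ∃ λ z → P z × (∀ y → P y → μ z ≤ μ y)
  argmin {P} P? {x} px = go (μ x) x px ≤-refl
    where
    go : ∀ k x → P x → μ x ≤ k → ∃ λ z → P z × (∀ y → P y → μ z ≤ μ y)
    go k x px le with any? (λ y → P? y ×-dec (μ y <? μ x))
    go k x px le | no ¬e = x , px , λ y py → ≮⇒≥ λ lt → ¬e (y , py , lt)
    go zero x px le | yes (y , py , lt) = ⊥-elim (<⇒≱ lt (≤-trans le z≤n))
    go (suc k) x px le | yes (y , py , lt) = go k y py (≤-pred (≤-trans lt le))

  argmax : ∀ {P : Fin n → Set} (P? : ∀ x → Dec (P x)) → ∀ {x} → P x → ∀ b → (∀ y → P y → μ y ≤ b) →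
           ∃ λ z → P z × (∀ y → P y → μ y ≤ μ z)
  argmax {P} P? {x} px b bd = go b x px (m≤n+m b (μ x))
    where
    go : ∀ k x → P x → b ≤ μ x + k → ∃ λ z → P z × (∀ y → P y → μ y ≤ μ z)
    go k x px le with any? (λ y → P? y ×-dec (μ x <? μ y))
    go k x px le | no ¬e = x , px , λ y py → ≮⇒≥ λ lt → ¬e (y , py , lt)
    go zero x px le | yes (y , py , lt) =
      ⊥-elim (<⇒≱ lt (≤-trans (bd y py) (≤-trans le (≤-reflexive (+-identityʳ (μ x))))))
    go (suc k) x px le | yes (y , py , lt) =
      go k y py (≤-trans le (≤-trans (≤-reflexive (+-suc (μ x) k)) (+-monoˡ-≤ k lt)))

funToFin-injective : ∀ {m k} {f g : Fin m → Fin k} → funToFin f ≡ funToFin g → ∀ i → f i ≡ g i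
funToFin-injective {f = f} {g} eq i =
  trans (≡sym (finToFun-funToFin f i)) (trans (cong (λ h → finToFun h i) eq) (finToFun-funToFin g i))

bit : {A : Set} → Dec A → Fin 2
bit (yes _) = suc zero
bit (no _)  = zero

bit-transfer : {A B : Set} (a : Dec A) (b : Dec B) → bit a ≡ bit b → A → B
bit-transfer _        (yes b) _  _ = b
bit-transfer (no ¬a)  (no _)  _  a = ⊥-elim (¬a a)

cap : ∀ p → ℕ → Fin (suc p)
cap p k = fromℕ< (s≤s (m⊓n≤n k p))

-- A truncated count is exact below the threshold, so it is enough to know that one of the two
-- counts is small.
cap-reflects-≤ : ∀ p {a b} → cap p a ≡ cap p b → b < p → a ≤ b
cap-reflects-≤ p {a} {b} eq b<p with a ≤? b
... | yes le = le
... | no nle = ⊥-elim (<⇒≱ (⊓-glb (≰⇒> nle) b<p) (begin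
    a ⊓ p        ≡⟨ toℕ-fromℕ< _ ⟨
    toℕ (cap p a) ≡⟨ cong toℕ eq ⟩
    toℕ (cap p b) ≡⟨ toℕ-fromℕ< _ ⟩
    b ⊓ p        ≤⟨ m⊓n≤m b p ⟩
    b            ∎))
  where open ≤-Reasoning

-- Random assignments by conditional expectations

prodFin : ∀ {n} → (Fin n → ℕ) → ℕ
prodFin {zero}  f = 1
prodFin {suc n} f = f zero * prodFin (f ∘ suc)

prod-zero : ∀ {n} (f : Fin n → ℕ) i → f i ≡ 0 → prodFin f ≡ 0
prod-zero f zero    eq rewrite eq = refl
prod-zero f (suc i) eq = trans (cong (f zero *_) (prod-zero (f ∘ suc) i eq)) (*-zeroʳ (f zero))

-- the contribution of a coordinate to K ^ |A| · [ g satisfies the constraint ]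
factor : {A B : Set} → ℕ → Dec A → Dec B → ℕ
factor K (no _)  _       = 1
factor K (yes _) (yes _) = K
factor K (yes _) (no _)  = 0

factor-zero : ∀ {A B : Set} K (a : Dec A) (b : Dec B) → A → ¬ B → factor K a b ≡ 0
factor-zero K (yes _) (yes b) _ ¬b = ⊥-elim (¬b b)
factor-zero K (yes _) (no _)  _ _  = refl
factor-zero K (no ¬a) _       a _  = ⊥-elim (¬a a)

prod-factor-≤ : ∀ {n} K {A B : Fin n → Set} (A? : ∀ w → Dec (A w)) (B? : ∀ w → Dec (B w)) →
                prodFin (λ w → factor K (A? w) (B? w)) ≤ K ^ # A?
prod-factor-≤ {zero}  K A? B? = ≤-refl
prod-factor-≤ {suc n} K A? B? with A? zero | B? zero
... | no _  | _     = ≤-trans (≤-reflexive (+-identityʳ _)) (prod-factor-≤ K (A? ∘ suc) (B? ∘ suc))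
... | yes _ | yes _ = *-monoʳ-≤ K (prod-factor-≤ K (A? ∘ suc) (B? ∘ suc))
... | yes _ | no _  = z≤n

-- A random g satisfies each constraint "g w ≡ τ w for all w ∈ A" with probability K ^ - |A|;
-- some g does at least as well as the weighted average (method of conditional expectations).
choose : ∀ n {K a b} → 0 < K → (wt : Fin a → Fin b → ℕ)
  {A : Fin a → Fin b → Fin n → Set} (A? : ∀ x y w → Dec (A x y w)) (τ : Fin a → Fin b → Fin n → Fin K) →
  ∃ λ (g : Fin n → Fin K) →
    sumFin (λ x → sumFin (wt x)) ≤
    sumFin (λ x → sumFin (λ y → wt x y * prodFin (λ w → factor K (A? x y w) (g w ≟ᶠ τ x y w))))
choose zero 0<K wt A? τ = (λ ()) ,
  ≤-reflexive (sum-cong λ x → sum-cong λ y → ≡sym (*-identityʳ (wt x y)))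
choose (suc n) {K} {a} {b} 0<K wt A? τ
  -- The first coordinate is fixed first: over its `K` values the totals add up to `K` times the
  -- original sum, so some `j` reaches the average. Its factor becomes part of the weight in the
  -- recursive call.
  with sum-∃≥ (λ j → sumFin (λ x → sumFin (F j x))) 0<K (≤-reflexive (≡sym total))
  where
  F : Fin K → Fin a → Fin b → ℕ
  F j x y = wt x y * factor K (A? x y zero) (j ≟ᶠ τ x y zero)
  one : ∀ {A : Set} (d : Dec A) t → sumFin {K} (λ j → factor K d (j ≟ᶠ t)) ≡ K
  one (no _)  t = trans (sum-const K 1) (*-identityʳ K)
  one (yes d) t = trans (sum-cong (λ j → aux (j ≟ᶠ t)))
    (trans (sum-* {K} K (λ j → ind (j ≟ᶠ t))) (trans (cong (K *_) #≡1) (*-identityʳ K)))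
    where
    aux : ∀ {B : Set} (e : Dec B) → factor K (yes d) e ≡ K * ind e
    aux (yes _) = ≡sym (*-identityʳ K)
    aux (no _)  = ≡sym (*-zeroʳ K)
    #≡1 : # (_≟ᶠ t) ≡ 1
    #≡1 = ≤-antisym (atMost⇒#≤ (_≟ᶠ t) ((λ _ _ → zero) , λ { refl refl _ → refl }))
                    (≤-trans (s≤s z≤n) (toℕ<n (index (_≟ᶠ t) t refl)))
  open ≡-Reasoning
  total : sumFin (λ j → sumFin (λ x → sumFin (F j x))) ≡ K * sumFin (λ x → sumFin (wt x))
  total = begin
    sumFin (λ j → sumFin (λ x → sumFin (F j x)))
      ≡⟨ sum-swap (λ j x → sumFin (F j x)) ⟩
    sumFin (λ x → sumFin (λ j → sumFin (F j x)))
      ≡⟨ sum-cong (λ x → sum-swap (λ j y → F j x y)) ⟩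
    sumFin (λ x → sumFin (λ y → sumFin (λ j → F j x y)))
      ≡⟨ sum-cong (λ x → sum-cong λ y → trans (sum-* {K} (wt x y) (λ j → factor K (A? x y zero) (j ≟ᶠ τ x y zero)))
           (trans (cong (wt x y *_) (one (A? x y zero) (τ x y zero))) (*-comm (wt x y) K))) ⟩
    sumFin (λ x → sumFin (λ y → K * wt x y))
      ≡⟨ sum-cong (λ x → sum-* K (wt x)) ⟩
    sumFin (λ x → K * sumFin (wt x))
      ≡⟨ sum-* K (λ x → sumFin (wt x)) ⟩
    K * sumFin (λ x → sumFin (wt x)) ∎
... | j , le with choose n 0<K (λ x y → wt x y * factor K (A? x y zero) (j ≟ᶠ τ x y zero))
                   (λ x y w → A? x y (suc w)) (λ x y w → τ x y (suc w))
... | g , le′ = g′ , ≤-trans le (≤-trans le′ (≤-reflexive (sum-cong λ x → sum-cong λ y →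
    *-assoc (wt x y) (factor K (A? x y zero) (j ≟ᶠ τ x y zero))
      (prodFin (λ w → factor K (A? x y (suc w)) (g w ≟ᶠ τ x y (suc w)))))))
  where
  g′ : Fin (suc n) → Fin K
  g′ zero    = j
  g′ (suc w) = g w

-- Weak reachability and shallow minors

module Reachability (G : Graph) (rk : Fin (n G) → ℕ) where

  -- Each vertex is compared with the end of the walk, not with its neighbour. Ranks may repeat:
  -- with rank 0 read as unranked, an unranked vertex reaches only itself and is reached only
  -- through ranked ones.
  data W : ℕ → Fin (n G) → Fin (n G) → Set where
    stop : ∀ {l z} → W l z z
    go   : ∀ {l a b z} → rk z < rk a → adj G a b ≡ true → W l b z → W (suc l) a z

  W? : ∀ l a z → Dec (W l a z)
  W? l a z with a ≟ᶠ z
  W? l a z | yes refl = yes stop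
  W? zero a z | no a≢z = no λ { stop → a≢z refl }
  W? (suc l) a z | no a≢z =
    map′ (λ { (lt , b , e , w) → go lt e w })
         (λ { stop → ⊥-elim (a≢z refl) ; (go lt e w) → lt , _ , e , w })
         ((rk z <? rk a) ×-dec any? (λ b → (adj G a b Boolₚ.≟ true) ×-dec W? l b z))

  W-mono : ∀ {l l′ a z} → l ≤ l′ → W l a z → W l′ a z
  W-mono _        stop         = stop
  W-mono (s≤s le) (go lt e w) = go lt e (W-mono le w)

  W-rk : ∀ {l a z} → W l a z → rk z ≤ rk a
  W-rk stop        = ≤-refl
  W-rk (go lt _ _) = <⇒≤ lt

  W-trans : ∀ {l l′ a b z} → W l a b → W l′ b z → W (l + l′) a z
  W-trans {l} stop w = W-mono (m≤n+m _ l) w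
  W-trans (go lt e v) w = go (≤-<-trans (W-rk w) lt) e (W-trans v w)

  -- The walk to `b` is reversed and put before the walk to `z`: its vertices are ranked no lower
  -- than `b`, hence above `z`. The recursion moves one edge at a time from the first walk to the
  -- second.
  W-fork : ∀ {l l′ a b z} → rk z < rk b → W l a b → W l′ a z → W (l + l′) b z
  W-fork {l} lt stop w = W-mono (m≤n+m _ l) w
  W-fork {suc l} {l′} {b = c} {z} lt (go {a = a} {b = a′} _ e v) w =
    subst (λ k → W k c z) (+-suc l l′)
      (W-fork lt v (go (<-≤-trans lt (W-rk v)) (trans (Graph.sym G a′ a) e) w))

module _ (G : Graph) where

  -- The walk stops at its first vertex outside `T`. If `T` consists of the vertices ranked no lower
  -- than the start, this is strong reachability; a general `T` also covers a start that is not yet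
  -- ranked.
  data SR (T : Fin (n G) → Set) : ℕ → Fin (n G) → Fin (n G) → Set where
    stop : ∀ {l y} → ¬ T y → SR T l y y
    go   : ∀ {l a b y} → T a → adj G a b ≡ true → SR T l b y → SR T (suc l) a y

  SR? : ∀ {T} → (∀ x → Dec (T x)) → ∀ l a y → Dec (SR T l a y)
  SR? T? zero a y with a ≟ᶠ y | T? y
  ... | yes refl | no ¬t = yes (stop ¬t)
  ... | yes refl | yes t = no λ { (stop ¬t) → ¬t t }
  ... | no a≢y   | _     = no λ { (stop _) → a≢y refl }
  SR? T? (suc l) a y =
    map′ (λ { (inj₁ (refl , ¬t)) → stop ¬t ; (inj₂ (t , _ , e , s)) → go t e s })
         (λ { (stop ¬t) → inj₁ (refl , ¬t) ; (go t e s) → inj₂ (t , _ , e , s) })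
         (((a ≟ᶠ y) ×-dec ¬? (T? y)) ⊎-dec
          (T? a ×-dec any? (λ b → (adj G a b Boolₚ.≟ true) ×-dec SR? T? l b y)))

  SR-map : ∀ {T T′ l a y} → (∀ x → T x → T′ x) → (∀ x → T′ x → T x) → SR T l a y → SR T′ l a y
  SR-map f g (stop ¬t)  = stop (¬t ∘ g _)
  SR-map f g (go t e s) = go (f _ t) e (SR-map f g s)

  SR-end : ∀ {T l a y} → SR T l a y → ¬ T y
  SR-end (stop ¬t)  = ¬t
  SR-end (go _ _ s) = SR-end s

  inner : ∀ {T l a y} → SR T l a y → List (Fin (n G))
  inner (stop _)           = []
  inner (go {a = a} _ _ s) = a ∷ inner s

  length-inner : ∀ {T l a y} (s : SR T l a y) → length (inner s) ≤ l
  length-inner (stop _)   = z≤n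
  length-inner (go _ _ s) = s≤s (length-inner s)

  data Rch (B : Fin (n G) → Set) (v : Fin (n G)) : ℕ → Fin (n G) → Set where
    start : ∀ {l} → Rch B v l v
    snoc  : ∀ {l a x} → Rch B v l a → adj G a x ≡ true → B x → Rch B v (suc l) x

  Rch? : ∀ {B v} → (∀ x → Dec (B x)) → ∀ l x → Dec (Rch B v l x)
  Rch? {v = v} B? l x with v ≟ᶠ x
  Rch? B? l x       | yes refl = yes start
  Rch? B? zero x    | no v≢x   = no λ { start → v≢x refl }
  Rch? B? (suc l) x | no v≢x   =
    map′ (λ { (b , _ , e , r) → snoc r e b })
         (λ { start → ⊥-elim (v≢x refl) ; (snoc r e b) → b , _ , e , r })
         (B? x ×-dec any? (λ a → (adj G a x Boolₚ.≟ true) ×-dec Rch? B? l a))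

  Rch-mono : ∀ {B v l l′ x} → l ≤ l′ → Rch B v l x → Rch B v l′ x
  Rch-mono _        start        = start
  Rch-mono (s≤s le) (snoc r e b) = snoc (Rch-mono le r) e b

  Rch-end : ∀ {B v l x} → B v → Rch B v l x → B x
  Rch-end bv start        = bv
  Rch-end bv (snoc _ _ b) = b

  WalkIn-snoc : ∀ {S x y z l} → WalkIn G S x y l → adj G y z ≡ true → S z ≡ true → WalkIn G S x z (suc l)
  WalkIn-snoc (here sx)      e sz = step sx e (here sz)
  WalkIn-snoc (step sx e′ w) e sz = step sx e′ (WalkIn-snoc w e sz)

  SR-exit : ∀ {T B v i l a b y} → adj G a b ≡ true → Rch B v i a → (s : SR T l b y) →
            (∀ w → w ∈ inner s → B w) → ∃ λ x → Rch B v (i + l) x × adj G x y ≡ true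
  SR-exit {i = i} e r (stop _) h = _ , Rch-mono (m≤m+n i _) r , e
  SR-exit {B = B} {v} {i = i} e r (go {l = l} _ e′ s) h with SR-exit e′ (snoc r e (h _ (here refl))) s (λ w m → h w (there m))
  ... | x , r′ , e″ = x , subst (λ k → Rch B v k x) (≡sym (+-suc i l)) r′ , e″

∈-atMost : ∀ {N k} (xs : List (Fin N)) → length xs ≤ k → AtMost k (_∈ xs)
∈-atMost xs le = atMost-weaken le ((λ _ m → Any.index m) ,
  λ p q eq → trans (lookup-index p) (trans (cong (List.lookup xs) eq) (≡sym (lookup-index q))))

isBranch-true : ∀ (G H : Graph) β u x → β x ≡ just u → isBranch G H β u x ≡ true
isBranch-true G H β u x eq with β x
isBranch-true G H β u x refl | just .u with u Fin.≟ u
... | yes _  = refl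
... | no u≢u = ⊥-elim (u≢u refl)

module Density (G : Graph) (rk : Fin (n G) → ℕ) (f : ℕ → ℕ)
               (sparse : ∀ d H → DepthMinor d H G → degreeSum H ≤ f d * n H) where

  open Reachability G rk

  private V = Fin (n G)

  Unranked : V → Set
  Unranked v = rk v ≡ 0

  unranked? : ∀ v → Dec (Unranked v)
  unranked? v = rk v ≟ 0

  RankedOr : V → V → Set
  RankedOr v x = x ≡ v ⊎ 0 < rk x

  rankedOr? : ∀ v x → Dec (RankedOr v x)
  rankedOr? v x = (x ≟ᶠ v) ⊎-dec (0 <? rk x)

  -- The vertices that become strongly `(l + 1)`-reachable from an unranked `v` once `v` is ranked
  -- next, below all ranked vertices.
  Y : ℕ → V → V → Set
  Y l v = SR G (RankedOr v) (suc l) v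

  Y? : ∀ l v y → Dec (Y l v y)
  Y? l v = SR? G (rankedOr? v) (suc l) v

  W-unranked : ∀ {l v z} → Unranked v → W l v z → v ≡ z
  W-unranked eq stop        = refl
  W-unranked eq (go lt _ _) = ⊥-elim (<⇒≱ lt (≤-trans (≤-reflexive eq) z≤n))

  tail-inner : ∀ {l v y} → Y l v y → List V
  tail-inner (stop _)   = []
  tail-inner (go _ _ s) = inner G s

  length-tail-inner : ∀ {l v y} (s : Y l v y) → length (tail-inner s) ≤ l
  length-tail-inner (stop _)   = z≤n
  length-tail-inner (go _ _ s) = length-inner G s

  -- Walking back to `v` meets only ranked vertices before `v`, which has rank 0, so the reversed
  -- walk witnesses weak reachability; `suc i` bounds the way back from `a`.
  inner-W : ∀ {i l v a y} → Unranked v → (s : SR G (RankedOr v) l a y) → (RankedOr v a → W (suc i) a v) →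
            ∀ w → w ∈ inner G s → W (i + l) w v
  inner-W {i} vu (go {l = l} t e s) h w (here refl) =
    W-mono (≤-trans (s≤s (m≤m+n i l)) (≤-reflexive (≡sym (+-suc i l)))) (h t)
  inner-W {i} {v = v} vu (go {l = l} {a = a} {b = b} t e s) h w (there m) =
    subst (λ k → W k w v) (≡sym (+-suc i l)) (inner-W vu s next w m)
    where
    next : RankedOr v b → W (suc (suc i)) b v
    next (inj₁ refl) = stop
    next (inj₂ lt)   = go (subst (_< rk b) (≡sym vu) lt) (trans (Graph.sym G b a) e) (h t)

  tail-inner-W : ∀ {l v y} → Unranked v → (s : Y l v y) → ∀ w → w ∈ tail-inner s → W l w v
  tail-inner-W {v = v} vu (go {a = a} {b = b} t e s) w m = inner-W {i = 0} vu s next w m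
    where
    next : RankedOr v b → W 1 b v
    next (inj₁ refl) = stop
    next (inj₂ lt)   = go (subst (_< rk b) (≡sym vu) lt) (trans (Graph.sym G b a) e) stop

  module _ (l K : ℕ) (0<K : 0 < K) (few : ∀ w → AtMost K (W l w)) where

    C : V → V → Set
    C v y = Unranked v × Y l v y

    C? : ∀ v y → Dec (C v y)
    C? v y = unranked? v ×-dec Y? l v y

    -- The value of the random choice with which `w` joins `v`. Where `w` does not reach `v` it is a
    -- filler, and `Branch` tests reachability separately.
    target : V → V → Fin K
    target v w with W? l w v
    ... | yes p = proj₁ (few w) v p
    ... | no _  = fromℕ< 0<K

    target-injective : ∀ {v v′ w} → W l w v → W l w v′ → target v w ≡ target v′ w → v ≡ v′
    target-injective {v} {v′} {w} p q eq with W? l w v | W? l w v′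
    ... | yes a | yes b = proj₂ (few w) a b eq
    ... | no ¬a | _     = ⊥-elim (¬a p)
    ... | _     | no ¬b = ⊥-elim (¬b q)

    route : ∀ {v y} → Dec (C v y) → List V
    route (yes (_ , s)) = tail-inner s
    route (no _)        = []

    length-route : ∀ {v y} (d : Dec (C v y)) → length (route d) ≤ l
    length-route (yes (_ , s)) = length-tail-inner s
    length-route (no _)        = z≤n

    open DecMembership (_≟ᶠ_ {n G}) using (_∈?_)

    onRoute? : ∀ v y w → Dec (w ∈ route (C? v y))
    onRoute? v y w = w ∈? route (C? v y)

    module _ (g : V → Fin K) where

      Branch : V → V → Set
      Branch v w = W l w v × (w ≡ v ⊎ g w ≡ target v w)

      Branch? : ∀ v w → Dec (Branch v w)
      Branch? v w = W? l w v ×-dec ((w ≟ᶠ v) ⊎-dec (g w ≟ᶠ target v w))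

      Branch-centre : ∀ v → Branch v v
      Branch-centre v = stop , inj₁ refl

      Branch-disjoint : ∀ {v v′ w} → Unranked v → Unranked v′ → Branch v w → Branch v′ w → v ≡ v′
      Branch-disjoint vu v′u (_ , inj₁ refl) (p , _)         = W-unranked vu p
      Branch-disjoint vu v′u (p , inj₂ _)    (_ , inj₁ refl) = ≡sym (W-unranked v′u p)
      Branch-disjoint vu v′u (p , inj₂ eq)   (q , inj₂ eq′)  = target-injective p q (trans (≡sym eq) eq′)

      -- Balls of radius `l` inside the branches are joined instead of the branches themselves,
      -- because for an arbitrary `g` a branch may be disconnected.
      Ed : V → V → Set
      Ed v y = v ≢ y × ∃ λ a → ∃ λ b →
        Rch G (Branch v) v l a × Rch G (Branch y) y l b × adj G a b ≡ true

      Ed? : ∀ v y → Dec (Ed v y)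
      Ed? v y = ¬? (v ≟ᶠ y) ×-dec any? λ a → any? λ b →
        Rch? G (Branch? v) l a ×-dec Rch? G (Branch? y) l b ×-dec (adj G a b Boolₚ.≟ true)

      Ed-sym : ∀ {v y} → Ed v y → Ed y v
      Ed-sym (ne , a , b , r , r′ , e) = ne ∘ ≡sym , b , a , r′ , r , trans (Graph.sym G b a) e

      centre : Fin (# unranked?) → V
      centre = enum unranked?

      minor : Graph
      minor = record
        { n   = # unranked?
        ; adj = λ u v → ⌊ Ed? (centre u) (centre v) ⌋
        ; sym = λ u v → sym′ (Ed? (centre u) (centre v)) (Ed? (centre v) (centre u)) Ed-sym Ed-sym
        ; irr = λ u → irr′ (Ed? (centre u) (centre u)) (λ ed → proj₁ ed refl)
        }
        where
        sym′ : ∀ {A B : Set} (a : Dec A) (b : Dec B) → (A → B) → (B → A) → ⌊ a ⌋ ≡ ⌊ b ⌋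
        sym′ (yes _) (yes _) _ _ = refl
        sym′ (no _)  (no _)  _ _ = refl
        sym′ (yes a) (no ¬b) h _ = ⊥-elim (¬b (h a))
        sym′ (no ¬a) (yes b) _ k = ⊥-elim (¬a (k b))
        irr′ : ∀ {A : Set} (a : Dec A) → ¬ A → ⌊ a ⌋ ≡ false
        irr′ (yes a) ¬a = ⊥-elim (¬a a)
        irr′ (no _)  _  = refl

      owner? : ∀ x → Dec (∃ λ u → Rch G (Branch (centre u)) (centre u) l x)
      owner? x = any? (λ u → Rch? G (Branch? (centre u)) l x)

      β : V → Maybe (Fin (# unranked?))
      β x with owner? x
      ... | yes (u , _) = just u
      ... | no _        = nothing

      β-sound : ∀ {x u} → β x ≡ just u → Rch G (Branch (centre u)) (centre u) l x
      β-sound {x} eq with owner? x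
      β-sound {x} refl | yes (u , r) = r

      β-complete : ∀ {x u} → Rch G (Branch (centre u)) (centre u) l x → β x ≡ just u
      β-complete {x} {u} r with owner? x
      ... | no ¬o = ⊥-elim (¬o (u , r))
      ... | yes (u′ , r′) = cong just (enum-injective unranked?
        (Branch-disjoint (enum-∈ unranked? u′) (enum-∈ unranked? u)
          (Rch-end G (Branch-centre _) r′) (Rch-end G (Branch-centre _) r)))

      minor-walk : ∀ u {i x} → i ≤ l → Rch G (Branch (centre u)) (centre u) i x →
                   Σ ℕ λ j → j ≤ i × WalkIn G (isBranch G minor β u) (centre u) x j
      minor-walk u le start = 0 , z≤n , here (isBranch-true G minor β u _ (β-complete start))
      minor-walk u le (snoc r e b) with minor-walk u (<⇒≤ le) r
      ... | j , j≤ , w = suc j , s≤s j≤ ,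
        WalkIn-snoc G w e (isBranch-true G minor β u _ (β-complete (Rch-mono G le (snoc r e b))))

      depthMinor : DepthMinor l minor G
      depthMinor = β , centre , (λ u → β-complete start)
        , (λ u x eq → minor-walk u ≤-refl (β-sound eq))
        , edges
        where
        fromTrue : ∀ {A : Set} (a : Dec A) → ⌊ a ⌋ ≡ true → A
        fromTrue (yes a) _ = a
        edges : ∀ u v → ⌊ Ed? (centre u) (centre v) ⌋ ≡ true →
                Σ V λ x → Σ V λ y → β x ≡ just u × β y ≡ just v × adj G x y ≡ true
        edges u v eq with fromTrue (Ed? (centre u) (centre v)) eq
        ... | _ , a , b , r , r′ , e = a , b , β-complete r , β-complete r′ , e

      -- If the whole route chooses `v`, the walk stays in the branch of `v` until its last step,
      -- and its end `y` is the centre of another branch.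
      edge-of-route : ∀ {v y} → Unranked v → (s : Y l v y) →
                      (∀ w → w ∈ tail-inner s → g w ≡ target v w) → Unranked y × Ed v y
      edge-of-route {v} {y} vu s@(go t e s′) sat = yu , v≢y , x , y , r , start , e′
        where
        ¬t = SR-end G s
        yu : Unranked y
        yu = n≤0⇒n≡0 (≮⇒≥ (λ lt → ¬t (inj₂ lt)))
        v≢y : v ≢ y
        v≢y refl = ¬t (inj₁ refl)
        exit = SR-exit G {B = Branch v} {v = v} {i = 0} e start s′
                 (λ w m → tail-inner-W vu s w m , inj₂ (sat w m))
        x  = proj₁ exit
        r  = proj₁ (proj₂ exit)
        e′ = proj₂ (proj₂ exit)
      edge-of-route vu (stop ¬t) sat = ⊥-elim (¬t (inj₁ refl))

      -- The product vanishes unless `g` agrees with the whole route. If it agrees, the route gives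
      -- an edge of the minor, and its at most `l` vertices contribute at most `K ^ l`.
      term : ∀ v y → ind (C? v y) * prodFin (λ w → factor K (onRoute? v y w) (g w ≟ᶠ target v w))
             ≤ ind (unranked? v) * (ind (unranked? y) * (K ^ l * ind (Ed? v y)))
      term v y with any? (λ w → onRoute? v y w ×-dec ¬? (g w ≟ᶠ target v w))
      ... | yes (w , m , ne) = ≤-trans (≤-reflexive (trans (cong (ind (C? v y) *_)
              (prod-zero _ w (factor-zero K (onRoute? v y w) (g w ≟ᶠ target v w) m ne))) (*-zeroʳ (ind (C? v y))))) z≤n
      ... | no ¬ex = aux (C? v y) refl
        where
        P = prodFin (λ w → factor K (onRoute? v y w) (g w ≟ᶠ target v w))
        P≤ : P ≤ K ^ l
        P≤ = ≤-trans (prod-factor-≤ K (onRoute? v y) (λ w → g w ≟ᶠ target v w))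
               (^-monoʳ-≤ K {{>-nonZero 0<K}}
                 (atMost⇒#≤ (onRoute? v y) (∈-atMost (route (C? v y)) (length-route (C? v y)))))
        one : ∀ {A : Set} (a : Dec A) → A → ind a ≡ 1
        one (yes _) _ = refl
        one (no ¬a) a = ⊥-elim (¬a a)
        -- The equation identifies the walk at hand with the one that `route` extracts from
        -- `C? v y`.
        aux : (d : Dec (C v y)) → C? v y ≡ d → ind d * P ≤ ind (unranked? v) * (ind (unranked? y) * (K ^ l * ind (Ed? v y)))
        aux (no _) _ = z≤n
        aux (yes (vu , s)) eq
          with edge-of-route vu s (λ w m → decidable-stable (g w ≟ᶠ target v w)
                 λ ne → ¬ex (w , subst (λ d → w ∈ route d) (≡sym eq) m , ne))
        ... | yu , ed rewrite one (unranked? v) vu | one (unranked? y) yu | one (Ed? v y) ed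
              | +-identityʳ P | +-identityʳ (K ^ l * 1) | +-identityʳ (K ^ l * 1) | *-identityʳ (K ^ l) = P≤

      degreeSum-minor : sumFin (λ v → ind (unranked? v) * sumFin (λ y → ind (unranked? y) * (K ^ l * ind (Ed? v y))))
                        ≡ K ^ l * degreeSum minor
      degreeSum-minor = begin
        sumFin (λ v → ind (unranked? v) * sumFin (λ y → ind (unranked? y) * (K ^ l * ind (Ed? v y))))
          ≡⟨ sum-enum unranked? (λ v → sumFin (λ y → ind (unranked? y) * (K ^ l * ind (Ed? v y)))) ⟩
        sumFin (λ u → sumFin (λ y → ind (unranked? y) * (K ^ l * ind (Ed? (centre u) y))))
          ≡⟨ sum-cong (λ u → sum-enum unranked? (λ y → K ^ l * ind (Ed? (centre u) y))) ⟩
        sumFin (λ u → sumFin (λ u′ → K ^ l * ind (Ed? (centre u) (centre u′))))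
          ≡⟨ sum-cong (λ u → sum-* (K ^ l) (λ u′ → ind (Ed? (centre u) (centre u′)))) ⟩
        sumFin (λ u → K ^ l * sumFin (λ u′ → ind (Ed? (centre u) (centre u′))))
          ≡⟨ sum-* (K ^ l) (λ u → sumFin (λ u′ → ind (Ed? (centre u) (centre u′)))) ⟩
        K ^ l * sumFin (λ u → sumFin (λ u′ → ind (Ed? (centre u) (centre u′))))
          ≡⟨ cong (K ^ l *_) (sum-cong λ u → sum-cong λ u′ → ind-if (Ed? (centre u) (centre u′))) ⟩
        K ^ l * degreeSum minor ∎
        where
        open ≡-Reasoning
        ind-if : ∀ {A : Set} (a : Dec A) → ind a ≡ (if ⌊ a ⌋ then 1 else 0)
        ind-if (yes _) = refl
        ind-if (no _)  = refl

    -- A random `g` turns a given pair into an edge with probability at least `K ^ - l`. Some `g`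
    -- attains the average, and the degree sum of its minor is bounded by sparsity.
    density : sumFin (λ v → ind (unranked? v) * # (Y? l v)) ≤ K ^ l * f l * # unranked?
    density with choose (n G) 0<K (λ v y → ind (C? v y)) onRoute? (λ v y w → target v w)
    ... | g , le = begin
      sumFin (λ v → ind (unranked? v) * # (Y? l v))
        ≡⟨ sum-cong (λ v → sum-* (ind (unranked? v)) (λ y → ind (Y? l v y))) ⟨
      sumFin (λ v → sumFin (λ y → ind (unranked? v) * ind (Y? l v y)))
        ≡⟨ sum-cong (λ v → sum-cong λ y → ind-× (unranked? v) (Y? l v y)) ⟩
      sumFin (λ v → sumFin (λ y → ind (C? v y)))
        ≤⟨ le ⟩
      sumFin (λ v → sumFin (λ y → ind (C? v y) * prodFin (λ w → factor K (onRoute? v y w) (g w ≟ᶠ target v w))))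
        ≤⟨ sum-mono (λ v → sum-mono (term g v)) ⟩
      sumFin (λ v → sumFin (λ y → ind (unranked? v) * (ind (unranked? y) * (K ^ l * ind (Ed? g v y)))))
        ≡⟨ sum-cong (λ v → sum-* (ind (unranked? v)) (λ y → ind (unranked? y) * (K ^ l * ind (Ed? g v y)))) ⟩
      sumFin (λ v → ind (unranked? v) * sumFin (λ y → ind (unranked? y) * (K ^ l * ind (Ed? g v y))))
        ≡⟨ degreeSum-minor g ⟩
      K ^ l * degreeSum (minor g)
        ≤⟨ *-monoʳ-≤ (K ^ l) (sparse l (minor g) (depthMinor g)) ⟩
      K ^ l * (f l * # unranked?)
        ≡⟨ *-assoc (K ^ l) (f l) _ ⟨
      K ^ l * f l * # unranked? ∎
      where
      open ≤-Reasoning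
      ind-× : ∀ {A B : Set} (a : Dec A) (b : Dec B) → ind a * ind b ≡ ind (a ×-dec b)
      ind-× (yes _) (yes _) = refl
      ind-× (yes _) (no _)  = refl
      ind-× (no _)  _       = refl

-- Orderings with bounded weak colouring numbers

module Bounds (f : ℕ → ℕ) where

  -- `K ^ l * f l` is the average from `density`. The factor `2 ^ suc l` makes the exceptions for
  -- `l` so rare that one vertex can be good for all `l` at once, however large `R` is.
  strongBound : ℕ → ℕ → ℕ
  strongBound K l = 2 ^ suc l * (K ^ l * f l)

  weakBound : ℕ → ℕ
  weakBound zero    = 1
  weakBound (suc l) = suc (strongBound (weakBound l) l * weakBound l)

  weakBound-pos : ∀ l → 0 < weakBound l
  weakBound-pos zero    = s≤s z≤n
  weakBound-pos (suc l) = s≤s z≤n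

-- Markov's inequality without division: `X * b` above `s` would force `b` to be 0.
average : ∀ X D b s → suc (X * D) * b ≤ D * s → X * b ≤ s
average X D b s le with X * b ≤? s
... | yes h = h
... | no ¬h = ⊥-elim (<⇒≱ (≰⇒> ¬h) (subst (λ k → X * k ≤ s) (≡sym b≡0) (≤-trans (≤-reflexive (*-zeroʳ X)) z≤n)))
  where
  open ≤-Reasoning
  b≡0 : b ≡ 0
  b≡0 = n≤0⇒n≡0 (+-cancelʳ-≤ (D * s) b 0 (begin
    b + D * s       ≤⟨ +-monoʳ-≤ b (*-monoʳ-≤ D (<⇒≤ (≰⇒> ¬h))) ⟩
    b + D * (X * b) ≡⟨ cong (b +_) (trans (≡sym (*-assoc D X b)) (cong (_* b) (*-comm D X))) ⟩
    b + X * D * b   ≤⟨ le ⟩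
    D * s           ∎))

update : ∀ {N} → (Fin N → ℕ) → Fin N → ℕ → Fin N → ℕ
update h v k x with x ≟ᶠ v
... | yes _ = k
... | no _  = h x

update-same : ∀ {N} (h : Fin N → ℕ) v k → update h v k v ≡ k
update-same h v k with v ≟ᶠ v
... | yes _ = refl
... | no ne = ⊥-elim (ne refl)

update-other : ∀ {N} (h : Fin N → ℕ) v k {x} → x ≢ v → update h v k x ≡ h x
update-other h v k {x} ne with x ≟ᶠ v
... | yes eq = ⊥-elim (ne eq)
... | no _   = refl

module Ordering (G : Graph) (f : ℕ → ℕ)
                (sparse : ∀ d H → DepthMinor d H G → degreeSum H ≤ f d * n H) (R : ℕ) where

  open Bounds f

  private V = Fin (n G)

  module Rank (rk : V → ℕ) where
    open Reachability G rk public
    open Density G rk f sparse public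

    above? : ∀ (b : ℕ) (z : V) → Dec (b ≤ rk z)
    above? b z = b ≤? rk z

  -- The top of the ordering is fixed and `s` vertices remain. Since ranked vertices lie above `s`,
  -- the next one can take rank `s`; `strong` survives, because later vertices are ranked below.
  record Stage (s : ℕ) : Set where
    field rk : V → ℕ
    open Rank rk
    field
      low    : ∀ x → rk x ≡ 0 ⊎ s < rk x
      count  : # unranked? ≡ s
      inj    : ∀ {x y} → 0 < rk x → rk x ≡ rk y → x ≡ y
      strong : ∀ x → 0 < rk x → ∀ l → l < R → # (SR? G (above? (rk x)) (suc l) x) ≤ strongBound (weakBound l) l

  module Weak {s : ℕ} (st : Stage s) where
    open Stage st
    open Rank rk

    split : ∀ {l a z b} → W l a z → rk z < b → ∃ λ y → SR G (λ x → b ≤ rk x) l a y × W l y z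
    split stop lt = _ , stop (<⇒≱ lt) , stop
    split {a = a} {b = b} (go lt′ e w) lt with b ≤? rk a
    ... | no ¬le = a , stop ¬le , go lt′ e w
    ... | yes le with split w lt
    ... | y , s′ , w′ = y , go le e s′ , W-mono (n≤1+n _) w′

    -- A walk from `x` down to `z` is coded by its first vertex `y` below `x`, which is strongly
    -- reachable, and by the code of `z` as seen from `y`; the extra code is for `x` itself. An
    -- unranked `x` reaches only itself.
    few : ∀ l → l ≤ R → ∀ x → AtMost (weakBound l) (W l x)
    few zero    _  x = (λ { _ stop → zero }) , λ { stop stop _ → refl }
    few (suc l) lR x with low x
    ... | inj₁ xu = (λ _ _ → zero) , λ p q _ → trans (≡sym (W-unranked xu p)) (W-unranked xu q)
    ... | inj₂ s<x = e , e-inj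
      where
      S = #≤⇒atMost (SR? G (above? (rk x)) (suc l) x) (strong x (≤-<-trans z≤n s<x) l lR)
      IH = few l (<⇒≤ lR)
      detour : ∀ {z} → rk z < rk x → ∀ {b} → adj G x b ≡ true → W l b z →
               ∃ λ y → SR G (λ a → rk x ≤ rk a) (suc l) x y × W l y z
      detour lt e w with split w lt
      ... | y , s′ , w′ = y , go ≤-refl e s′ , w′
      code : ∀ {z} → (∃ λ y → SR G (λ a → rk x ≤ rk a) (suc l) x y × W l y z) → Fin (strongBound (weakBound l) l * weakBound l)
      code {z} (y , s′ , w′) = combine (proj₁ S y s′) (proj₁ (IH y) z w′)
      code-inj : ∀ {z z′} d d′ → code {z} d ≡ code {z′} d′ → z ≡ z′
      code-inj (y , s₁ , w₁) (y′ , s₂ , w₂) eq with combine-injective _ _ _ _ eq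
      ... | eq₁ , eq₂ with proj₂ S s₁ s₂ eq₁
      ... | refl = proj₂ (IH y) w₁ w₂ eq₂
      e : ∀ z → W (suc l) x z → Fin (weakBound (suc l))
      e z stop         = zero
      e z (go lt ab w) = suc (code (detour lt ab w))
      e-inj : ∀ {z z′} p q → e z p ≡ e z′ q → z ≡ z′
      e-inj stop stop _ = refl
      e-inj (go lt ab w) (go lt′ ab′ w′) eq = code-inj (detour lt ab w) (detour lt′ ab′ w′) (suc-injective eq)

  module Select {s : ℕ} (st : Stage (suc s)) where
    open Stage st
    open Rank rk
    open Weak st

    Bad : ℕ → V → Set
    Bad l v = Unranked v × strongBound (weakBound l) l < # (Y? l v)

    Bad? : ∀ l v → Dec (Bad l v)
    Bad? l v = unranked? v ×-dec (strongBound (weakBound l) l <? # (Y? l v))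

    bad-few : ∀ l → l < R → 2 ^ suc l * # (Bad? l) ≤ # unranked?
    bad-few l lR = average (2 ^ suc l) (weakBound l ^ l * f l) (# (Bad? l)) (# unranked?) (begin
      suc q * # (Bad? l)
        ≡⟨ sum-* (suc q) (λ v → ind (Bad? l v)) ⟨
      sumFin (λ v → suc q * ind (Bad? l v))
        ≤⟨ sum-mono (λ v → aux (unranked? v) (q <? # (Y? l v))) ⟩
      sumFin (λ v → ind (unranked? v) * # (Y? l v))
        ≤⟨ density l (weakBound l) (weakBound-pos l) (few l (<⇒≤ lR)) ⟩
      weakBound l ^ l * f l * # unranked? ∎)
      where
      open ≤-Reasoning
      q = strongBound (weakBound l) l
      aux : ∀ {A : Set} {k} (a : Dec A) (b : Dec (q < k)) → suc q * ind (a ×-dec b) ≤ ind a * k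
      aux {k = k} (yes _) (yes lt) = ≤-trans (≤-reflexive (*-identityʳ (suc q))) (≤-trans lt (≤-reflexive (≡sym (+-identityʳ k))))
      aux (yes _) (no _) = ≤-trans (≤-reflexive (*-zeroʳ (suc q))) z≤n
      aux (no _)  _      = ≤-trans (≤-reflexive (*-zeroʳ (suc q))) z≤n

    BadBelow : ℕ → V → Set
    BadBelow zero    v = ⊥
    BadBelow (suc L) v = BadBelow L v ⊎ Bad L v

    BadBelow? : ∀ L v → Dec (BadBelow L v)
    BadBelow? zero    v = no λ ()
    BadBelow? (suc L) v = BadBelow? L v ⊎-dec Bad? L v

    bad⇒badBelow : ∀ {L l v} → l < L → Bad l v → BadBelow L v
    bad⇒badBelow {suc L} (s≤s l≤L) b with m≤n⇒m<n∨m≡n l≤L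
    ... | inj₁ lt   = inj₁ (bad⇒badBelow lt b)
    ... | inj₂ refl = inj₂ b

    -- Σ 2^-(l+1) < 1
    badBelow-few : ∀ L → L ≤ R → 2 ^ L * # (BadBelow? L) + # unranked? ≤ 2 ^ L * # unranked?
    badBelow-few zero _ = +-monoˡ-≤ (# unranked?) (≤-reflexive
      (trans (+-identityʳ _) (trans (sum-const (n G) 0) (*-zeroʳ (n G))))) ⟨ ≤-trans ⟩ ≤-reflexive (≡sym (+-identityʳ _))
    badBelow-few (suc L) LR = begin
      2 ^ suc L * # (BadBelow? (suc L)) + S
        ≤⟨ +-monoˡ-≤ S (*-monoʳ-≤ (2 ^ suc L) (#-union (BadBelow? (suc L)) (BadBelow? L) (Bad? L) (λ _ b → b))) ⟩
      2 ^ suc L * (N + B) + S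
        ≡⟨ cong (_+ S) (*-distribˡ-+ (2 ^ suc L) N B) ⟩
      2 ^ suc L * N + 2 ^ suc L * B + S
        ≤⟨ +-monoˡ-≤ S (+-monoʳ-≤ (2 ^ suc L * N) (bad-few L LR)) ⟩
      2 ^ suc L * N + S + S
        ≡⟨ solve 3 (λ x k s → con 2 :* x :* k :+ s :+ s := con 2 :* (x :* k :+ s)) refl (2 ^ L) N S ⟩
      2 * (2 ^ L * N + S)
        ≤⟨ *-monoʳ-≤ 2 (badBelow-few L (<⇒≤ LR)) ⟩
      2 * (2 ^ L * S)
        ≡⟨ *-assoc 2 (2 ^ L) S ⟨
      2 ^ suc L * S ∎
      where
      open ≤-Reasoning
      open +-*-Solver
      S = # unranked?
      N = # (BadBelow? L)
      B = # (Bad? L)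

    -- The vertices that are bad for some `l < R` are fewer than the unranked ones; strictness comes
    -- from `count`, which is positive.
    pick : ∃ λ v → Unranked v × (∀ l → l < R → # (Y? l v) ≤ strongBound (weakBound l) l)
    pick with #-<⇒∃ (BadBelow? R) unranked? lt
      where
      lt : # (BadBelow? R) < # unranked?
      lt = *-cancelˡ-< (2 ^ R) _ _ (<-≤-trans
        (m<m+n (2 ^ R * # (BadBelow? R)) (subst (0 <_) (≡sym count) (s≤s z≤n))) (badBelow-few R ≤-refl))
    ... | v , vu , ¬b = v , vu , λ l lR → ≮⇒≥ λ lt → ¬b (bad⇒badBelow lR (vu , lt))

  module Update {s : ℕ} (st : Stage (suc s)) (v : Fin (n G)) (vu : Stage.rk st v ≡ 0)
                (good : ∀ l → l < R → # (Density.Y? G (Stage.rk st) f sparse l v) ≤ strongBound (weakBound l) l) where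
    open Stage st
    open Rank rk

    rk′ : V → ℕ
    rk′ = update rk v (suc s)

    module R′ = Rank rk′

    rk′-v : rk′ v ≡ suc s
    rk′-v = update-same rk v (suc s)

    rk′-≢ : ∀ {x} → x ≢ v → rk′ x ≡ rk x
    rk′-≢ = update-other rk v (suc s)

    low′ : ∀ x → rk′ x ≡ 0 ⊎ s < rk′ x
    low′ x with x ≟ᶠ v | low x
    ... | yes _ | _       = inj₂ ≤-refl
    ... | no _  | inj₁ eq = inj₁ eq
    ... | no _  | inj₂ lt = inj₂ (<⇒≤ lt)

    0<⇒≢v : ∀ {x} → 0 < rk x → x ≢ v
    0<⇒≢v lt refl = <⇒≢ lt (≡sym vu)

    0<⇒high : ∀ {x} → 0 < rk x → suc s < rk x
    0<⇒high {x} lt with low x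
    ... | inj₁ eq = ⊥-elim (<⇒≢ lt (≡sym eq))
    ... | inj₂ h  = h

    count′ : # R′.unranked? ≡ s
    count′ = ≤-antisym
      (≤-pred (subst (# R′.unranked? <_) count
        (#-mono-< R′.unranked? unranked? old v vu λ eq → 1+n≢0 (trans (≡sym rk′-v) eq))))
      (≤-pred (begin
        suc s                           ≡⟨ count ⟨
        # unranked?                     ≤⟨ #-union unranked? (_≟ᶠ v) R′.unranked? split′ ⟩
        # (_≟ᶠ v) + # R′.unranked?      ≤⟨ +-monoˡ-≤ _ (atMost⇒#≤ {N = 1} (_≟ᶠ v) ((λ _ _ → zero) , λ { refl refl _ → refl })) ⟩
        suc (# R′.unranked?)            ∎))
      where
      open ≤-Reasoning
      old : ∀ x → rk′ x ≡ 0 → rk x ≡ 0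
      old x eq with x ≟ᶠ v
      ... | no _ = eq
      split′ : ∀ x → rk x ≡ 0 → x ≡ v ⊎ rk′ x ≡ 0
      split′ x eq with x ≟ᶠ v
      ... | yes x≡v = inj₁ x≡v
      ... | no _    = inj₂ eq

    inj′ : ∀ {x y} → 0 < rk′ x → rk′ x ≡ rk′ y → x ≡ y
    inj′ {x} {y} lt eq with x ≟ᶠ v | y ≟ᶠ v
    ... | yes p | yes q = trans p (≡sym q)
    ... | yes _ | no _  = ⊥-elim (<⇒≢ (0<⇒high (subst (0 <_) eq (s≤s z≤n))) eq)
    ... | no _  | yes _ = ⊥-elim (<⇒≢ (0<⇒high lt) (≡sym eq))
    ... | no _  | no _  = inj lt eq

    -- At or above the new rank of `v` lie `v` and the ranked vertices, as in `Y`. For an older `x`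
    -- the set above it is unchanged, since `v` moves from 0 to a rank still below `x`.
    strong′ : ∀ x → 0 < rk′ x → ∀ l → l < R → # (SR? G (R′.above? (rk′ x)) (suc l) x) ≤ strongBound (weakBound l) l
    strong′ x lt l lR = by (x ≟ᶠ v)
      where
      by : Dec (x ≡ v) → # (SR? G (R′.above? (rk′ x)) (suc l) x) ≤ strongBound (weakBound l) l
      by (yes refl) = ≤-trans
        (#-mono (SR? G (R′.above? (rk′ v)) (suc l) v) (Y? l v) (λ y → SR-map G to from)) (good l lR)
        where
        to : ∀ z → rk′ v ≤ rk′ z → RankedOr v z
        to z le with z ≟ᶠ v
        ... | yes eq = inj₁ eq
        ... | no _   = inj₂ (<-≤-trans lt le)
        from : ∀ z → RankedOr v z → rk′ v ≤ rk′ z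
        from z (inj₁ refl) = ≤-refl
        from z (inj₂ h)    = ≤-trans (≤-reflexive rk′-v)
          (≤-trans (<⇒≤ (0<⇒high h)) (≤-reflexive (≡sym (rk′-≢ (0<⇒≢v h)))))
      by (no x≢v) = ≤-trans
        (#-mono (SR? G (R′.above? (rk′ x)) (suc l) x) (SR? G (above? (rk x)) (suc l) x) (λ y → SR-map G to from))
        (strong x 0<x l lR)
        where
        0<x : 0 < rk x
        0<x = subst (0 <_) (rk′-≢ x≢v) lt
        to : ∀ z → rk′ x ≤ rk′ z → rk x ≤ rk z
        to z le with z ≟ᶠ v
        ... | yes _ = ⊥-elim (<⇒≱ (0<⇒high 0<x) (≤-trans (≤-reflexive (≡sym (rk′-≢ x≢v))) le))
        ... | no _  = ≤-trans (≤-reflexive (≡sym (rk′-≢ x≢v))) le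
        from : ∀ z → rk x ≤ rk z → rk′ x ≤ rk′ z
        from z le = ≤-trans (≤-reflexive (rk′-≢ x≢v)) (≤-trans le (≤-reflexive (≡sym (rk′-≢
          λ { refl → <⇒≱ 0<x (≤-trans le (≤-reflexive vu)) }))))

    updated : Stage s
    updated = record { rk = rk′ ; low = low′ ; count = count′ ; inj = inj′ ; strong = strong′ }

  initial : Stage (n G)
  initial = record
    { rk = λ _ → 0 ; low = λ _ → inj₁ refl ; count = trans (sum-const (n G) 1) (*-identityʳ (n G))
    ; inj = λ () ; strong = λ _ () }

  descend : ∀ {s} → Stage s → Stage 0
  descend {zero}  st = st
  descend {suc s} st with Select.pick st
  ... | v , vu , good = descend (Update.updated st v vu good)

  final : Stage 0
  final = descend initial

  open Stage final

  order : V → ℕ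
  order = rk

  order-injective : ∀ {x y} → order x ≡ order y → x ≡ y
  order-injective {x} eq with low x
  ... | inj₂ lt  = inj lt eq
  ... | inj₁ eq₀ = ⊥-elim (<⇒≢ (≤-<-trans z≤n (toℕ<n (index (Rank.unranked? rk) x eq₀))) (≡sym count))

  order-weak : ∀ l → l ≤ R → ∀ x → AtMost (weakBound l) (Reachability.W G order l x)
  order-weak = Weak.few final

-- Rainbow colourings of reachability sets

≤sumFin : ∀ {N} (h : Fin N → ℕ) x → h x ≤ sumFin h
≤sumFin h zero    = m≤m+n _ _
≤sumFin h (suc x) = ≤-trans (≤sumFin (h ∘ suc) x) (m≤n+m _ (h zero))

module Greedy {N M : ℕ} (rk : Fin N → ℕ) {B : Fin N → Fin N → Set} (B? : ∀ x y → Dec (B x y))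
              (B-rk : ∀ {x y} → B x y → rk y < rk x) (few : ∀ x → AtMost M (B x)) where

  free : ∀ (c : Fin N → Fin (suc M)) x → ∃ λ i → ∀ y → B x y → i ≢ c y
  free c x with any? (λ i → all? (λ y → B? x y →-dec ¬? (i ≟ᶠ c y)))
  ... | yes e = e
  ... | no ¬e = ⊥-elim (1+n≰n (injective⇒≤ {f = code} code-inj))
    where
    used : ∀ i → ∃ λ y → B x y × i ≡ c y
    used i with any? (λ y → B? x y ×-dec (i ≟ᶠ c y))
    ... | yes u = u
    ... | no ¬u = ⊥-elim (¬e (i , λ y b eq → ¬u (y , b , eq)))
    code : Fin (suc M) → Fin M
    code i = proj₁ (few x) (proj₁ (used i)) (proj₁ (proj₂ (used i)))
    code-inj : ∀ {i j} → code i ≡ code j → i ≡ j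
    code-inj {i} {j} eq = trans (proj₂ (proj₂ (used i)))
      (trans (cong c (proj₂ (few x) _ _ eq)) (≡sym (proj₂ (proj₂ (used j)))))

  -- Vertices are coloured by increasing rank. A whole rank level can be treated at once because `B`
  -- strictly lowers the rank.
  colourBelow : ∀ s → ∃ λ (c : Fin N → Fin (suc M)) → ∀ x y → rk x < s → B x y → c x ≢ c y
  colourBelow zero = (λ _ → zero) , λ _ _ ()
  colourBelow (suc s) with colourBelow s
  ... | c , proper = c′ , proper′
    where
    c′ : Fin N → Fin (suc M)
    c′ x with rk x ≟ s
    ... | yes _ = proj₁ (free c x)
    ... | no _  = c x
    proper′ : ∀ x y → rk x < suc s → B x y → c′ x ≢ c′ y
    proper′ x y (s≤s le) b with rk x ≟ s | rk y ≟ s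
    ... | yes x≡s | yes y≡s = ⊥-elim (<⇒≢ (B-rk b) (trans y≡s (≡sym x≡s)))
    ... | yes _   | no _    = proj₂ (free c x) y b
    ... | no _    | yes y≡s = ⊥-elim (<⇒≱ (B-rk b) (≤-trans le (≤-reflexive (≡sym y≡s))))
    ... | no x≢s  | no _    = proper x y (≤∧≢⇒< le x≢s) b

  colouring : ∃ λ (c : Fin N → Fin (suc M)) → ∀ x y → B x y → c x ≢ c y
  colouring with colourBelow (suc (sumFin rk))
  ... | c , proper = c , λ x y → proper x y (s≤s (≤sumFin rk x))

-- W l x is the set of vertices weakly l-reachable from x, enlarged by a fixed vertex `root`
-- so that any two of these sets intersect.
record System (G : Graph) (m R : ℕ) (Mb : ℕ → ℕ) : Set₁ where
  field
    rk     : Fin (n G) → ℕ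
    rk-inj : ∀ {x y} → rk x ≡ rk y → x ≡ y
    W      : ℕ → Fin (n G) → Fin (n G) → Set
    W?     : ∀ l x z → Dec (W l x z)
    W-refl : ∀ {l x} → W l x x
    W-mono : ∀ {l l′ x z} → l ≤ l′ → W l x z → W l′ x z
    W-rk   : ∀ {l x z} → W l x z → rk z ≤ rk x
    W-trans : ∀ {l l′ x y z} → W l x y → W l′ y z → W (l + l′) x z
    W-fork : ∀ {l l′ x y z} → rk z ≤ rk y → W l x y → W l′ x z → W (l + l′) y z
    W-edge : ∀ {x y} → adj G x y ≡ true → rk y < rk x → W 1 x y
    W-few  : ∀ {l} → l ≤ R → ∀ x → # (W? l x) ≤ Mb l
    root   : Fin (n G)
    W-root : ∀ {l x} → W l x root
    c      : Fin (n G) → Fin m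
    c-inj  : ∀ {x z z′} → W R x z → W R x z′ → c z ≡ c z′ → z ≡ z′

module _ (G : Graph) (f : ℕ → ℕ) (sparse : ∀ d H → DepthMinor d H G → degreeSum H ≤ f d * n H) where

  open Bounds f

  -- Of two members of `W R x` the higher one reaches the lower one through `x` in `R + R` steps, so
  -- a proper colouring for that distance is rainbow on `W R x`. The root has least rank, hence
  -- reaches only itself, and adding it keeps transitivity and forks.
  system : Fin (n G) → ∀ R → System G (suc (suc (weakBound (R + R)))) R (λ l → suc (weakBound l))
  system v₀ R = record
    { rk = order ; rk-inj = order-injective ; W = W⁺ ; W? = W⁺?
    ; W-refl = inj₁ stop ; W-mono = mono⁺ ; W-rk = rk⁺ ; W-trans = trans⁺ ; W-fork = fork⁺
    ; W-edge = λ e lt → inj₁ (go lt e stop)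
    ; W-few = λ {l} lR x → atMost⇒#≤ (W⁺? l x) (few⁺ l (≤-trans lR (m≤m+n R R)) x)
    ; root = root ; W-root = inj₂ refl ; c = c ; c-inj = inj⁺ }
    where
    open Ordering G f sparse (R + R)
    open Reachability G order
    minimum : ∃ λ z → z ≡ z × (∀ y → y ≡ y → order z ≤ order y)
    minimum = argmin order {P = λ z → z ≡ z} (λ _ → yes refl) {v₀} refl
    root : Fin (n G)
    root = proj₁ minimum
    root-min : ∀ y → order root ≤ order y
    root-min y = proj₂ (proj₂ minimum) y refl
    W⁺ : ℕ → Fin (n G) → Fin (n G) → Set
    W⁺ l x z = W l x z ⊎ z ≡ root
    W⁺? : ∀ l x z → Dec (W⁺ l x z)
    W⁺? l x z = W? l x z ⊎-dec (z ≟ᶠ root)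
    mono⁺ : ∀ {l l′ x z} → l ≤ l′ → W⁺ l x z → W⁺ l′ x z
    mono⁺ le (inj₁ w) = inj₁ (W-mono le w)
    mono⁺ le (inj₂ e) = inj₂ e
    rk⁺ : ∀ {l x z} → W⁺ l x z → order z ≤ order x
    rk⁺ (inj₁ w)    = W-rk w
    rk⁺ (inj₂ refl) = root-min _
    only-root : ∀ {l z} → W⁺ l root z → z ≡ root
    only-root w = order-injective (≤-antisym (rk⁺ w) (root-min _))
    trans⁺ : ∀ {l l′ x y z} → W⁺ l x y → W⁺ l′ y z → W⁺ (l + l′) x z
    trans⁺ _           (inj₂ e) = inj₂ e
    trans⁺ (inj₁ v)    (inj₁ w) = inj₁ (W-trans v w)
    trans⁺ (inj₂ refl) w        = inj₂ (only-root w)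
    fork⁺ : ∀ {l l′ x y z} → order z ≤ order y → W⁺ l x y → W⁺ l′ x z → W⁺ (l + l′) y z
    fork⁺ le _           (inj₂ e) = inj₂ e
    fork⁺ le (inj₂ refl) (inj₁ w) = inj₂ (order-injective (≤-antisym le (root-min _)))
    fork⁺ le (inj₁ v)    (inj₁ w) with m≤n⇒m<n∨m≡n le
    ... | inj₁ lt = inj₁ (W-fork lt v w)
    ... | inj₂ eq with order-injective eq
    ... | refl = inj₁ stop
    few⁺ : ∀ l → l ≤ R + R → ∀ x → AtMost (suc (weakBound l)) (W⁺ l x)
    few⁺ l lR x = e , e-inj
      where
      F = order-weak l lR x
      e : ∀ z → W⁺ l x z → Fin (suc (weakBound l))
      e z (inj₁ w) = suc (proj₁ F z w)
      e z (inj₂ _) = zero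
      e-inj : ∀ {z z′} p q → e z p ≡ e z′ q → z ≡ z′
      e-inj (inj₁ p) (inj₁ q) eq = proj₂ F p q (suc-injective eq)
      e-inj (inj₂ p) (inj₂ q) eq = trans p (≡sym q)
    Conflict : Fin (n G) → Fin (n G) → Set
    Conflict x y = x ≢ y × W⁺ (R + R) x y
    greedy : ∃ λ (c : Fin (n G) → Fin (suc (suc (weakBound (R + R))))) → ∀ x y → Conflict x y → c x ≢ c y
    greedy = Greedy.colouring order {Conflict} (λ x y → ¬? (x ≟ᶠ y) ×-dec W⁺? (R + R) x y)
      (λ { (ne , w) → ≤∧≢⇒< (rk⁺ w) (λ eq → ne (≡sym (order-injective eq))) })
      (λ x → (λ y b → proj₁ (few⁺ (R + R) ≤-refl x) y (proj₂ b)) ,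
             λ p q → proj₂ (few⁺ (R + R) ≤-refl x) (proj₂ p) (proj₂ q))
    c : Fin (n G) → Fin (suc (suc (weakBound (R + R))))
    c = proj₁ greedy
    inj⁺ : ∀ {x z z′} → W⁺ R x z → W⁺ R x z′ → c z ≡ c z′ → z ≡ z′
    inj⁺ {x} {z} {z′} p q eq = decidable-stable (z ≟ᶠ z′) clash
      where
      clash : ¬ ¬ z ≡ z′
      clash ne with ≤-total (order z) (order z′)
      ... | inj₁ le = proj₂ greedy z′ z (ne ∘ ≡sym , fork⁺ le q p) (≡sym eq)
      ... | inj₂ le = proj₂ greedy z z′ (ne , fork⁺ le p q) eq

-- First-order types

qr : ∀ {k m} → Formula k m → ℕ
qr (edge _ _)  = 0
qr (equal _ _) = 0
qr (pred _ _)  = 0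
qr (neg φ)     = qr φ
qr (conj φ ψ)  = qr φ ⊔ qr ψ
qr (disj φ ψ)  = qr φ ⊔ qr ψ
qr (ex φ)      = suc (qr φ)
qr (all φ)     = suc (qr φ)

-- The bracket bounds the threshold of `search`, which starts at `3r` and grows by `2r` at most
-- `Mb r` times. Two further terms `2r` lead to the lower branching vertex and from there to the
-- elements below it.
radius : (ℕ → ℕ) → ℕ → ℕ
radius Mb zero    = 1
radius Mb (suc q) = let r = radius Mb q in (r + r + r + (r + r) * Mb r) + (r + r) + (r + r)

radius-pos : ∀ Mb q → 1 ≤ radius Mb q
radius-pos Mb zero    = ≤-refl
radius-pos Mb (suc q) = let r = radius Mb q in
  ≤-trans (radius-pos Mb q) (≤-trans (m≤m+n r r) (m≤n+m (r + r) (r + r + r + (r + r) * Mb r + (r + r))))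

baseSize : ℕ → ℕ → ℕ → ℕ
baseSize m R k = m * (2 ^ k * ((2 ^ m) ^ suc R * (2 ^ m * (2 ^ m) ^ m)))

typeSize : ℕ → ℕ → ℕ → ℕ → ℕ → ℕ
typeSize m R k p zero    = baseSize m R k
typeSize m R k p (suc q) = let N = typeSize m R k p q in
  N * (N ^ m * (((suc p ^ m) ^ m) ^ N * ((2 ^ m) ^ m) ^ N))

module _ {V : Set} where

  _⊗_ : ∀ {a b} → (V → Fin a) → (V → Fin b) → V → Fin (a * b)
  (f ⊗ g) x = combine (f x) (g x)

  ⊗-injective : ∀ {a b} (f : V → Fin a) (g : V → Fin b) {x x′} → (f ⊗ g) x ≡ (f ⊗ g) x′ → f x ≡ f x′ × g x ≡ g x′
  ⊗-injective f g {x} {x′} = combine-injective (f x) (g x) (f x′) (g x′)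

  table : ∀ {k a} → (V → Fin k → Fin a) → V → Fin (a ^ k)
  table t x = funToFin (t x)

  table-at : ∀ {k a} (t : V → Fin k → Fin a) {x x′} → table t x ≡ table t x′ → ∀ i → t x i ≡ t x′ i
  table-at t {x} {x′} eq = funToFin-injective {f = t x} {g = t x′} eq

anyFin-true : ∀ {N} (h : Fin N → Bool) i → h i ≡ true → anyFin h ≡ true
anyFin-true h zero    eq rewrite eq = refl
anyFin-true h (suc i) eq with h zero
... | true  = refl
... | false = anyFin-true (h ∘ suc) i eq

anyFin-witness : ∀ {N} (h : Fin N → Bool) → anyFin h ≡ true → ∃ λ i → h i ≡ true
anyFin-witness {suc N} h eq with h zero in eq₀
... | true  = zero , eq₀
... | false with anyFin-witness (h ∘ suc) eq
... | i , e = suc i , e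

bool-ext : ∀ {a b : Bool} → (a ≡ true → b ≡ true) → (b ≡ true → a ≡ true) → a ≡ b
bool-ext {true}  {true}  _ _ = refl
bool-ext {false} {false} _ _ = refl
bool-ext {true}  {false} f _ = ≡sym (f refl)
bool-ext {false} {true}  _ g = g refl

anyFin-matching : ∀ {N N′} (h : Fin N → Bool) (h′ : Fin N′ → Bool) →
  (∀ i → ∃ λ j → h i ≡ h′ j) → (∀ j → ∃ λ i → h i ≡ h′ j) → anyFin h ≡ anyFin h′
anyFin-matching h h′ forth back = bool-ext to from
  where
  to : anyFin h ≡ true → anyFin h′ ≡ true
  to eq with anyFin-witness h eq
  ... | i , e with forth i
  ... | j , e′ = anyFin-true h′ j (trans (≡sym e′) e)
  from : anyFin h′ ≡ true → anyFin h ≡ true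
  from eq with anyFin-witness h′ eq
  ... | j , e with back j
  ... | i , e′ = anyFin-true h i (trans e′ e)

allFin-anyFin : ∀ {N} (h : Fin N → Bool) → allFin h ≡ not (anyFin (not ∘ h))
allFin-anyFin {zero}  h = refl
allFin-anyFin {suc N} h with h zero
... | true  = allFin-anyFin (h ∘ suc)
... | false = refl

module Types {G : Graph} {m R : ℕ} {Mb : ℕ → ℕ} (S : System G m R Mb)
             {kP : ℕ} (P : Fin kP → Fin (n G) → Bool) (p : ℕ) where

  open System S

  private V = Fin (n G)

  at? : ∀ x i → Dec (∃ λ z → W R x z × c z ≡ i)
  at? x i = any? (λ z → W? R x z ×-dec (c z ≟ᶠ i))

  -- the vertex of colour i in W R x; the junk value x if there is none
  w : V → Fin m → V
  w x i with at? x i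
  ... | yes (z , _) = z
  ... | no _        = x

  w-unique : ∀ {l x z i} → l ≤ R → W l x z → c z ≡ i → w x i ≡ z
  w-unique {x = x} {z} {i} lR q refl with at? x (c z)
  ... | yes (z′ , q′ , eq) = c-inj q′ (W-mono lR q) eq
  ... | no ¬e = ⊥-elim (¬e (z , W-mono lR q , refl))

  -- The colour condition excludes the junk value: `x` lies in `W R x`, so it is junk only for
  -- colours other than its own.
  Bd : ℕ → V → Fin m → Set
  Bd l x i = W l x (w x i) × c (w x i) ≡ i

  Bd? : ∀ l x i → Dec (Bd l x i)
  Bd? l x i = W? l x (w x i) ×-dec (c (w x i) ≟ᶠ i)

  Bd-intro : ∀ {l x z i} → l ≤ R → W l x z → c z ≡ i → Bd l x i
  Bd-intro {l} {x} {z} {i} lR q eq with w x i | w-unique lR q eq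
  ... | _ | refl = q , eq

  Bd-mono : ∀ {l l′ x i} → l ≤ l′ → Bd l x i → Bd l′ x i
  Bd-mono le (q , eq) = W-mono le q , eq

  predBit : V → Fin kP → Fin 2
  predBit x k = bit (P k x Boolₚ.≟ true)

  reachBit : Fin (suc R) → V → Fin m → Fin 2
  reachBit l x i = bit (Bd? (toℕ l) x i)

  reachBits : V → Fin (suc R) → Fin (2 ^ m)
  reachBits x l = table (reachBit l) x

  adjBit : V → Fin m → Fin 2
  adjBit x i = bit (adj G x (w x i) Boolₚ.≟ true)

  rankBit : Fin m → V → Fin m → Fin 2
  rankBit i x j = bit (rk (w x i) <? rk (w x j))

  rankBits : V → Fin m → Fin (2 ^ m)
  rankBits x i = table (rankBit i) x

  base : V → Fin (baseSize m R kP)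
  base = c ⊗ (table predBit ⊗ (table reachBits ⊗ (table adjBit ⊗ table rankBits)))

  module Base {x x′ : V} (eq : base x ≡ base x′) where
    private
      e₁ = ⊗-injective c (table predBit ⊗ (table reachBits ⊗ (table adjBit ⊗ table rankBits))) {x} {x′} eq
      e₂ = ⊗-injective (table predBit) (table reachBits ⊗ (table adjBit ⊗ table rankBits)) {x} {x′} (proj₂ e₁)
      e₃ = ⊗-injective (table reachBits) (table adjBit ⊗ table rankBits) {x} {x′} (proj₂ e₂)
      e₄ = ⊗-injective (table adjBit) (table rankBits) {x} {x′} (proj₂ e₃)

    c-eq : c x ≡ c x′
    c-eq = proj₁ e₁

    pred-to : ∀ k → P k x ≡ true → P k x′ ≡ true
    pred-to k = bit-transfer (P k x Boolₚ.≟ true) (P k x′ Boolₚ.≟ true) (table-at predBit {x} {x′} (proj₁ e₂) k)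

    Bd-to : ∀ {l i} → l ≤ R → Bd l x i → Bd l x′ i
    Bd-to {l} {i} lR b = subst (λ k → Bd k x′ i) l≡
      (bit-transfer (Bd? (toℕ lf) x i) (Bd? (toℕ lf) x′ i)
        (table-at (reachBit lf) {x} {x′} (table-at reachBits {x} {x′} (proj₁ e₃) lf) i) (subst (λ k → Bd k x i) (≡sym l≡) b))
      where
      lf = fromℕ< (s≤s lR)
      l≡ : toℕ lf ≡ l
      l≡ = toℕ-fromℕ< (s≤s lR)

    adj-to : ∀ i → adj G x (w x i) ≡ true → adj G x′ (w x′ i) ≡ true
    adj-to i = bit-transfer (adj G x (w x i) Boolₚ.≟ true) (adj G x′ (w x′ i) Boolₚ.≟ true) (table-at adjBit {x} {x′} (proj₁ e₄) i)

    rank-to : ∀ i j → rk (w x i) < rk (w x j) → rk (w x′ i) < rk (w x′ j)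
    rank-to i j = bit-transfer (rk (w x i) <? rk (w x j)) (rk (w x′ i) <? rk (w x′ j))
      (table-at (rankBit i) {x} {x′} (table-at rankBits {x} {x′} (proj₂ e₄) i) j)

  rad : ℕ → ℕ
  rad = radius Mb

  size : ℕ → ℕ
  size = typeSize m R kP p

  -- For the types `χ q`, the order of `z` and `v` within `W r y` is carried by `γ`, which records
  -- the colours present and their ranking.
  Child : ∀ {N} → (V → Fin N) → ℕ → Fin N → Fin m → V → V → Set
  Child χ r γ i z v = c v ≡ i × ∃ λ y → χ y ≡ γ × W r y z × W r y v

  Child? : ∀ {N} (χ : V → Fin N) r γ i z v → Dec (Child χ r γ i z v)
  Child? χ r γ i z v = (c v ≟ᶠ i) ×-dec any? (λ y → (χ y ≟ᶠ γ) ×-dec W? r y z ×-dec W? r y v)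

  module Refinement {N : ℕ} (χ : V → Fin N) (r : ℕ) where

    typeAt : V → Fin m → Fin N
    typeAt x i = χ (w x i)

    countAt : Fin N → Fin m → V → Fin m → Fin (suc p)
    countAt γ i x j = cap p (# (Child? χ r γ j (w x i)))

    countsAt : Fin N → V → Fin m → Fin (suc p ^ m)
    countsAt γ x i = table (countAt γ i) x

    counts : V → Fin N → Fin ((suc p ^ m) ^ m)
    counts x γ = table (countsAt γ) x

    childAt : Fin N → Fin m → V → Fin m → Fin 2
    childAt γ i x j = bit (Child? χ r γ j (w x i) (w x j))

    childrenAt : Fin N → V → Fin m → Fin (2 ^ m)
    childrenAt γ x i = table (childAt γ i) x

    children : V → Fin N → Fin ((2 ^ m) ^ m)
    children x γ = table (childrenAt γ) x

    -- The types at `w x i` answer a new vertex near the tuple. The capped numbers of children, and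
    -- the bits telling which `w x j` are children, answer one that branches off.
    refined : V → Fin (N * (N ^ m * (((suc p ^ m) ^ m) ^ N * ((2 ^ m) ^ m) ^ N)))
    refined = χ ⊗ (table typeAt ⊗ (table counts ⊗ table children))

    module _ {x x′ : V} (eq : refined x ≡ refined x′) where
      private
        e₁ = ⊗-injective χ (table typeAt ⊗ (table counts ⊗ table children)) {x} {x′} eq
        e₂ = ⊗-injective (table typeAt) (table counts ⊗ table children) {x} {x′} (proj₂ e₁)
        e₃ = ⊗-injective (table counts) (table children) {x} {x′} (proj₂ e₂)

      χ-pred : χ x ≡ χ x′
      χ-pred = proj₁ e₁

      χ-at : ∀ i → χ (w x i) ≡ χ (w x′ i)
      χ-at = table-at typeAt {x} {x′} (proj₁ e₂)

      count-at : ∀ γ i j → cap p (# (Child? χ r γ j (w x i))) ≡ cap p (# (Child? χ r γ j (w x′ i)))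
      count-at γ i = table-at (countAt γ i) {x} {x′} (table-at (countsAt γ) {x} {x′} (table-at counts {x} {x′} (proj₁ e₃) γ) i)

      child-to : ∀ γ i j → Child χ r γ j (w x i) (w x j) → Child χ r γ j (w x′ i) (w x′ j)
      child-to γ i j = bit-transfer (Child? χ r γ j (w x i) (w x j)) (Child? χ r γ j (w x′ i) (w x′ j))
        (table-at (childAt γ i) {x} {x′} (table-at (childrenAt γ) {x} {x′} (table-at children {x} {x′} (proj₂ e₃) γ) i) j)

  χ : ∀ q → V → Fin (size q)
  χ zero    = base
  χ (suc q) = Refinement.refined (χ q) (rad q)

  module Refine (q : ℕ) = Refinement (χ q) (rad q)

  χ⇒base : ∀ q {x x′} → χ q x ≡ χ q x′ → base x ≡ base x′
  χ⇒base zero    eq = eq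
  χ⇒base (suc q) eq = χ⇒base q (Refine.χ-pred q eq)

  -- The back-and-forth game

  record Sim (q : ℕ) {k : ℕ} (x x′ : Fin k → V) : Set where
    field
      types : ∀ a → χ q (x a) ≡ χ q (x′ a)
      to    : ∀ a b i → Bd (rad q) (x a) i → Bd (rad q) (x b) i → w (x a) i ≡ w (x b) i → w (x′ a) i ≡ w (x′ b) i
      from  : ∀ a b i → Bd (rad q) (x′ a) i → Bd (rad q) (x′ b) i → w (x′ a) i ≡ w (x′ b) i → w (x a) i ≡ w (x b) i
    bases : ∀ a → base (x a) ≡ base (x′ a)
    bases a = χ⇒base q (types a)

  Sim-sym : ∀ {q k} {x x′ : Fin k → V} → Sim q x x′ → Sim q x′ x
  Sim-sym s = record { types = λ a → ≡sym (Sim.types s a) ; to = Sim.from s ; from = Sim.to s }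

  module Step (q : ℕ) (R≥ : rad (suc q) ≤ R) where

    r = rad q
    r′ = rad (suc q)
    ρmax = r + r + r + (r + r) * Mb r

    ρ+4r≤r′ : ∀ {ρ} → ρ ≤ ρmax → ρ + (r + r) + (r + r) ≤ r′
    ρ+4r≤r′ le = +-monoˡ-≤ (r + r) (+-monoˡ-≤ (r + r) le)

    ρ+2r≤r′ : ∀ {ρ} → ρ ≤ ρmax → ρ + (r + r) ≤ r′
    ρ+2r≤r′ le = ≤-trans (m≤m+n _ _) (ρ+4r≤r′ le)

    ρ≤r′ : ∀ {ρ} → ρ ≤ ρmax → ρ ≤ r′
    ρ≤r′ le = ≤-trans (m≤m+n _ _) (ρ+2r≤r′ le)

    3r≤ρmax : r + r + r ≤ ρmax
    3r≤ρmax = m≤m+n _ _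

    r≤3r : r ≤ r + r + r
    r≤3r = m≤n+m r (r + r)

    r≤r′ : r ≤ r′
    r≤r′ = ≤-trans r≤3r (ρ≤r′ 3r≤ρmax)

    r≤R : r ≤ R
    r≤R = ≤-trans r≤r′ R≥

    Cross : ∀ {k} → V → (Fin k → V) → V → (Fin k → V) → Set
    Cross y x y′ x′ = ∀ b i → Bd r y i → Bd r (x b) i → w y i ≡ w (x b) i → w y′ i ≡ w (x′ b) i

    Sim-extend : ∀ {k y y′} {x x′ : Fin k → V} → Sim (suc q) x x′ → χ q y ≡ χ q y′ →
                 Cross y x y′ x′ → Cross y′ x′ y x → Sim q (extend y x) (extend y′ x′)
    Sim-extend {k} {y} {y′} {x} {x′} s eq cr cr′ = record
      { types = λ { zero → eq ; (suc a) → Refine.χ-pred q (Sim.types s a) }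
      ; to = half y y′ x x′ cr (Sim.to s) ; from = half y′ y x′ x cr′ (Sim.from s) }
      where
      half : ∀ y y′ (x x′ : Fin k → V) → Cross y x y′ x′ →
        (∀ a b i → Bd r′ (x a) i → Bd r′ (x b) i → w (x a) i ≡ w (x b) i → w (x′ a) i ≡ w (x′ b) i) →
        ∀ a b i → Bd r (extend y x a) i → Bd r (extend y x b) i → w (extend y x a) i ≡ w (extend y x b) i →
        w (extend y′ x′ a) i ≡ w (extend y′ x′ b) i
      half y y′ x x′ cr t zero    zero    i _ _  _ = refl
      half y y′ x x′ cr t zero    (suc b) i p p′ e = cr b i p p′ e
      half y y′ x x′ cr t (suc a) zero    i p p′ e = ≡sym (cr a i p′ p (≡sym e))
      half y y′ x x′ cr t (suc a) (suc b) i p p′ e = t a b i (Bd-mono r≤r′ p) (Bd-mono r≤r′ p′) e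

    -- Seen from `x a`, the vertex of colour `i` is `w y i` itself, so the equation is one between
    -- two members of the tuple and `Sim.to` carries it over.
    cross-via : ∀ {k y y′} {x x′ : Fin k → V} → Sim (suc q) x x′ → ∀ a b i →
      c (w y i) ≡ i → W r′ (x a) (w y i) → c (w y′ i) ≡ i → W r′ (x′ a) (w y′ i) →
      Bd r (x b) i → w y i ≡ w (x b) i → w y′ i ≡ w (x′ b) i
    cross-via {x = x} {x′} s a b i ci wa ci′ wa′ bd eq =
      trans (≡sym (w-unique R≥ wa′ ci′))
        (Sim.to s a b i (Bd-intro R≥ wa ci) (Bd-mono r≤r′ bd) (trans (w-unique R≥ wa ci) eq))

    cross-near : ∀ {k y y′} {x x′ : Fin k → V} → Sim (suc q) x x′ → χ q y ≡ χ q y′ → ∀ a →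
      W (r + r + r) (x a) y → W (r + r + r) (x′ a) y′ → Cross y x y′ x′
    cross-near s eq a wa wa′ b i bd bd′ e =
      cross-via s a b i (proj₂ bd) (near wa (proj₁ bd)) (proj₂ bdy′) (near wa′ (proj₁ bdy′)) bd′ e
      where
      bdy′ = Base.Bd-to (χ⇒base q eq) r≤R bd
      near : ∀ {x y z} → W (r + r + r) x y → W r y z → W r′ x z
      near v w′ = W-mono (≤-trans (+-monoʳ-≤ (r + r + r) (m≤m+n r r)) (ρ+2r≤r′ 3r≤ρmax)) (W-trans v w′)

    -- y branches off from the tuple x between the consecutive elements w y i and w y j of W r y.
    record Fit {k} (y : V) (x : Fin k → V) (a : Fin k) (i j : Fin m) (ρ : ℕ) : Set where
      field
        lower : Bd r y i
        upper : Bd r y j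
        less  : rk (w y i) < rk (w y j)
        consecutive : ∀ h → Bd r y h → rk (w y i) < rk (w y h) → rk (w y j) ≤ rk (w y h)
        close : W (ρ + (r + r)) (x a) (w y i)
        far   : ∀ b → ¬ W ρ (x b) (w y j)

    -- A common element of `W r y` and `W r (x b)` lies no higher than `w y i`: otherwise a fork at
    -- `y` would bring `w y j` within `3r ≤ ρ` of `x b`, against `far`. Elements that low are
    -- visible from `x a`, on both sides.
    cross-fit : ∀ {k y y′ a i j ρ} {x x′ : Fin k → V} → Sim (suc q) x x′ → χ q y ≡ χ q y′ →
      r + r + r ≤ ρ → ρ ≤ ρmax → Fit y x a i j ρ → Fit y′ x′ a i j ρ → Cross y x y′ x′
    cross-fit {y = y} {y′} {a} {i} {j} {ρ} {x} {x′} s eq 3r≤ ≤max fit fit′ b h bd bd′ e =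
      cross-via s a b h (proj₂ bd) (reach fit bd below) (proj₂ bdy′) (reach fit′ bdy′ below′) bd′ e
      where
      bdy′ = Base.Bd-to (χ⇒base q eq) r≤R bd
      below : rk (w y h) ≤ rk (w y i)
      below = ≮⇒≥ λ lt → Fit.far fit b (W-mono (≤-trans (≤-reflexive (≡sym (+-assoc r r r))) 3r≤)
        (W-trans (subst (W r (x b)) (≡sym e) (proj₁ bd′))
          (W-fork (Fit.consecutive fit h bd lt) (proj₁ bd) (proj₁ (Fit.upper fit)))))
      below′ : rk (w y′ h) ≤ rk (w y′ i)
      below′ = ≮⇒≥ λ lt → <⇒≱ (Base.rank-to (χ⇒base q (≡sym eq)) i h lt) below
      reach : ∀ {y x} → Fit y x a i j ρ → Bd r y h → rk (w y h) ≤ rk (w y i) → W r′ (x a) (w y h)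
      reach fit bd le = W-mono (ρ+4r≤r′ ≤max) (W-trans (Fit.close fit) (W-fork le (proj₁ (Fit.lower fit)) (proj₁ bd)))

    module _ {k : ℕ} (a₀ : Fin k) (x : Fin k → V) (y : V) where

      Below : V → V → Set
      Below u z = W r y z × rk z < rk u

      Below? : ∀ u z → Dec (Below u z)
      Below? u z = W? r y z ×-dec (rk z <? rk u)

      -- Descends through `W r y` while `u` is out of reach of the tuple. If its predecessor is out
      -- of reach even at `ρ + 2r`, it replaces `u` and `ρ` grows accordingly; `t` bounds the
      -- elements left. As every vertex reaches the root, `u` is never the root and the descent must
      -- stop.
      search : ∀ t u ρ → # (Below? u) ≤ t → W r y u → (∀ b → ¬ W ρ (x b) u) →
               r + r + r ≤ ρ → ρ + (r + r) * t ≤ ρmax →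
               ∃ λ a → ∃ λ i → ∃ λ j → ∃ λ ρ′ → r + r + r ≤ ρ′ × ρ′ ≤ ρmax × Fit y x a i j ρ′
      search t u ρ few wu far 3r≤ ≤max = by t (any? λ a → W? (ρ + (r + r)) (x a) z) few ≤max
        where
        root<u : rk root < rk u
        root<u = ≤∧≢⇒< (W-rk (W-root {0})) λ eq → far a₀ (subst (W ρ (x a₀)) (rk-inj eq) W-root)
        top = argmax rk (Below? u) {root} (W-root , root<u) (rk u) (λ _ bl → <⇒≤ (proj₂ bl))
        z = proj₁ top
        wz : W r y z
        wz = proj₁ (proj₁ (proj₂ top))
        z<u : rk z < rk u
        z<u = proj₂ (proj₁ (proj₂ top))
        by : ∀ t → Dec (∃ λ a → W (ρ + (r + r)) (x a) z) → # (Below? u) ≤ t → ρ + (r + r) * t ≤ ρmax →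
             ∃ λ a → ∃ λ i → ∃ λ j → ∃ λ ρ′ → r + r + r ≤ ρ′ × ρ′ ≤ ρmax × Fit y x a i j ρ′
        by t (yes (a , wa)) few ≤max = a , c z , c u , ρ , 3r≤ , ≤-trans (m≤m+n ρ _) ≤max , record
          { lower = Bd-intro r≤R wz refl
          ; upper = Bd-intro r≤R wu refl
          ; less  = subst₂ _<_ (cong rk (≡sym z≡)) (cong rk (≡sym u≡)) z<u
          ; consecutive = λ h bd lt → subst (λ v → rk v ≤ rk (w y h)) (≡sym u≡)
              (≮⇒≥ λ lt′ → <⇒≱ lt (subst (λ v → rk (w y h) ≤ rk v) (≡sym z≡) (proj₂ (proj₂ top) (w y h) (proj₁ bd , lt′))))
          ; close = subst (W (ρ + (r + r)) (x a)) (≡sym z≡) wa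
          ; far   = λ b wb → far b (subst (W ρ (x b)) u≡ wb) }
          where
          z≡ : w y (c z) ≡ z
          z≡ = w-unique r≤R wz refl
          u≡ : w y (c u) ≡ u
          u≡ = w-unique r≤R wu refl
        by zero (no _) few ≤max =
          ⊥-elim (<⇒≱ (≤-<-trans z≤n (toℕ<n (index (Below? u) z (wz , z<u)))) few)
        by (suc t) (no ¬close) few ≤max = search t z (ρ + (r + r))
          (≤-pred (≤-trans (#-mono-< (Below? z) (Below? u) (λ _ bl → proj₁ bl , <-trans (proj₂ bl) z<u) z (wz , z<u)
            (λ bl → <-irrefl refl (proj₂ bl))) few))
          wz (λ b wb → ¬close (b , wb)) (≤-trans 3r≤ (m≤m+n ρ _))
          (≤-trans (≤-reflexive (trans (+-assoc ρ (r + r) _) (cong (ρ +_) (≡sym (*-suc (r + r) t))))) ≤max)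

    module _ {k : ℕ} (k<p : k < p) {x x′ : Fin k → V} (s : Sim (suc q) x x′)
             {y : V} {a : Fin k} {i j : Fin m} {ρ : ℕ} (≤max : ρ ≤ ρmax) (fit : Fit y x a i j ρ) where

      private
        open Fit fit
        γ = χ q y
        z  = w y i
        z′ = w (x′ a) i
        ρ≤R : ρ ≤ R
        ρ≤R = ≤-trans (ρ≤r′ ≤max) R≥
        ρ2≤R : ρ + (r + r) ≤ R
        ρ2≤R = ≤-trans (ρ+2r≤r′ ≤max) R≥
        xa≡z : w (x a) i ≡ z
        xa≡z = w-unique ρ2≤R close (proj₂ lower)
        bd′ : Bd (ρ + (r + r)) (x′ a) i
        bd′ = Base.Bd-to (Sim.bases s a) ρ2≤R (Bd-intro ρ2≤R close (proj₂ lower))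
        Ch? = Child? (χ q) r γ j

      -- The witness inside a child has the type of `y`, so its colours `i` and `j` are again
      -- consecutive; uniqueness of colours identifies them with `z′` and `v`.
      fit-of : ∀ v → Child (χ q) r γ j z′ v → (∀ b → ¬ W ρ (x′ b) v) → ∃ λ y′ → χ q y ≡ χ q y′ × Fit y′ x′ a i j ρ
      fit-of v (cv , y′ , eq , wz , wv) far′ = y′ , ≡sym eq , record
        { lower = Base.Bd-to be r≤R lower
        ; upper = Base.Bd-to be r≤R upper
        ; less  = Base.rank-to be i j less
        ; consecutive = λ h bd lt → ≮⇒≥ λ lt′ → <⇒≱ (Base.rank-to be′ h j lt′)
            (consecutive h (Base.Bd-to be′ r≤R bd) (Base.rank-to be′ i h lt))
        ; close = subst (W (ρ + (r + r)) (x′ a)) (≡sym (w-unique r≤R wz (proj₂ bd′))) (proj₁ bd′)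
        ; far   = λ b wb → far′ b (subst (W ρ (x′ b)) (w-unique r≤R wv cv) wb) }
        where
        be : base y ≡ base y′
        be = χ⇒base q (≡sym eq)
        be′ : base y′ ≡ base y
        be′ = χ⇒base q eq

      -- otherwise the children of z′ would inject into those of z other than w y j
      transfer-fit : ∃ λ y′ → χ q y ≡ χ q y′ × Fit y′ x′ a i j ρ
      transfer-fit with any? (λ v → Ch? z′ v ×-dec all? (λ b → ¬? (W? ρ (x′ b) v)))
      ... | yes (v , ch , far′) = fit-of v ch far′
      -- Every child now lies within `ρ` of a member of the tuple, and that owner determines it. So
      -- there are at most `k < p` children of `z′`, and the capped counts can be compared.
      ... | no ¬ex = ⊥-elim (<⇒≱ fewer (cap-reflects-≤ p
              (trans (cong (λ v → cap p (# (Ch? v))) (≡sym xa≡z)) (Refine.count-at q (Sim.types s a) γ i j))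
              (≤-<-trans (atMost⇒#≤ (Ch? z′) (owner , λ {v} {v′} ch ch′ eq →
                c-inj (W-mono ρ≤R (owner-W v ch)) (W-mono ρ≤R (subst (λ b → W ρ (x′ b) v′) (≡sym eq) (owner-W v′ ch′)))
                  (trans (proj₁ ch) (≡sym (proj₁ ch′))))) k<p)))
        where
        owned : ∀ v → Child (χ q) r γ j z′ v → ∃ λ b → W ρ (x′ b) v
        owned v ch with any? (λ b → W? ρ (x′ b) v)
        ... | yes o = o
        ... | no ¬o = ⊥-elim (¬ex (v , ch , λ b wb → ¬o (b , wb)))
        owner : ∀ v → Child (χ q) r γ j z′ v → Fin k
        owner v ch = proj₁ (owned v ch)
        owner-W : ∀ v ch → W ρ (x′ (owner v ch)) v
        owner-W v ch = proj₂ (owned v ch)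
        at-upper : ∀ v ch → w (x′ (owner v ch)) j ≡ v
        at-upper v ch = w-unique ρ≤R (owner-W v ch) (proj₁ ch)
        upper-bd′ : ∀ v ch → Bd ρ (x′ (owner v ch)) j
        upper-bd′ v ch = Bd-intro ρ≤R (owner-W v ch) (proj₁ ch)
        upper-bd : ∀ v ch → Bd ρ (x (owner v ch)) j
        upper-bd v ch = Base.Bd-to (≡sym (Sim.bases s (owner v ch))) ρ≤R (upper-bd′ v ch)
        lower-W : ∀ v ch → W (ρ + (r + r)) (x′ (owner v ch)) z′
        lower-W v ch@(cv , y₀ , eq , wz , wv) = W-trans (owner-W v ch) (W-fork (<⇒≤ z′<v) wv wz)
          where
          z′<v : rk z′ < rk v
          z′<v = subst₂ (λ a b → rk a < rk b) (w-unique r≤R wz (proj₂ bd′)) (w-unique r≤R wv cv)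
            (Base.rank-to (χ⇒base q (≡sym eq)) i j less)
        at-lower′ : ∀ v ch → w (x′ (owner v ch)) i ≡ z′
        at-lower′ v ch = w-unique ρ2≤R (lower-W v ch) (proj₂ bd′)
        -- The owner and `x′ a` share `z′` at colour `i`. `Sim.from` moves this equation to the
        -- tuple `x`, so the child bit of the owner speaks about `z`.
        at-lower : ∀ v ch → w (x (owner v ch)) i ≡ z
        at-lower v ch = trans (Sim.from s (owner v ch) a i
          (Bd-mono (ρ+2r≤r′ ≤max) (Bd-intro ρ2≤R (lower-W v ch) (proj₂ bd′)))
          (Bd-mono (ρ+2r≤r′ ≤max) bd′) (at-lower′ v ch)) xa≡z
        image : ∀ v → Child (χ q) r γ j z′ v → V
        image v ch = w (x (owner v ch)) j
        image-child : ∀ v ch → Child (χ q) r γ j z (image v ch)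
        image-child v ch = subst (λ u → Child (χ q) r γ j u (image v ch)) (at-lower v ch)
          (Refine.child-to q (≡sym (Sim.types s (owner v ch))) γ i j
            (subst₂ (Child (χ q) r γ j) (≡sym (at-lower′ v ch)) (≡sym (at-upper v ch)) ch))
        image-inj : ∀ {v v′} ch ch′ → image v ch ≡ image v′ ch′ → v ≡ v′
        image-inj {v} {v′} ch ch′ eq = trans (≡sym (at-upper v ch)) (trans
          (Sim.to s (owner v ch) (owner v′ ch′) j
            (Bd-mono (ρ≤r′ ≤max) (upper-bd v ch)) (Bd-mono (ρ≤r′ ≤max) (upper-bd v′ ch′)) eq) (at-upper v′ ch′))
        fewer : # (Ch? z′) < # (Ch? z)
        fewer = #-injection-< (Ch? z′) (Ch? z) image image-child image-inj
          (w y j) (proj₂ upper , y , refl , proj₁ lower , proj₁ upper)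
          (λ v ch eq → far (owner v ch) (subst (W ρ (x (owner v ch))) eq (proj₁ (upper-bd v ch))))

    -- A `y` seen from `x a` is answered by the vertex of its colour seen from `x′ a`. Any other `y`
    -- branches off where `search` finds it, and `transfer-fit` supplies the answer.
    forth : ∀ {k} → Fin k → k < p → {x x′ : Fin k → V} → Sim (suc q) x x′ →
            ∀ y → ∃ λ y′ → Sim q (extend y x) (extend y′ x′)
    forth {k} a₀ k<p {x} {x′} s y with any? (λ a → W? (r + r + r) (x a) y)
    ... | yes (a , wa) = y′ , Sim-extend s χ≡ (cross-near s χ≡ a wa wa′)
                                (cross-near (Sim-sym s) (≡sym χ≡) a wa′ wa)
      where
      3r≤R : r + r + r ≤ R
      3r≤R = ≤-trans (ρ≤r′ 3r≤ρmax) R≥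
      y′ = w (x′ a) (c y)
      χ≡ : χ q y ≡ χ q y′
      χ≡ = subst (λ v → χ q v ≡ χ q y′) (w-unique 3r≤R wa refl) (Refine.χ-at q (Sim.types s a) (c y))
      wa′ : W (r + r + r) (x′ a) y′
      wa′ = proj₁ (Base.Bd-to (Sim.bases s a) 3r≤R (Bd-intro 3r≤R wa refl))
    ... | no ¬near with search a₀ x y (Mb r) y (r + r + r)
                          (≤-trans (#-mono (Below? a₀ x y y) (W? r y) (λ _ → proj₁)) (W-few r≤R y))
                          W-refl (λ b wb → ¬near (b , wb)) ≤-refl ≤-refl
    ... | a , i , j , ρ , 3r≤ , ≤max , fit with transfer-fit k<p s ≤max fit
    ... | y′ , χ≡ , fit′ = y′ , Sim-extend s χ≡ (cross-fit s χ≡ 3r≤ ≤max fit fit′)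
                                  (cross-fit (Sim-sym s) (≡sym χ≡) 3r≤ ≤max fit′ fit)

  Sim-equal : ∀ {q k} {x x′ : Fin k → V} → rad q ≤ R → Sim q x x′ → ∀ a b → x a ≡ x b → x′ a ≡ x′ b
  Sim-equal {q} {x = x} {x′} rR s a b eq =
    trans (≡sym (own a ca′)) (trans (Sim.to s a b i (bd a ca) (bd b cb) (cong (λ v → w v i) eq)) (own b cb′))
    where
    i = c (x a)
    ca : c (x a) ≡ i
    ca = refl
    cb : c (x b) ≡ i
    cb = cong c (≡sym eq)
    ca′ : c (x′ a) ≡ i
    ca′ = ≡sym (Base.c-eq (Sim.bases s a))
    cb′ : c (x′ b) ≡ i
    cb′ = trans (≡sym (Base.c-eq (Sim.bases s b))) cb
    bd : ∀ a → c (x a) ≡ i → Bd (rad q) (x a) i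
    bd a = Bd-intro rR W-refl
    own : ∀ a → c (x′ a) ≡ i → w (x′ a) i ≡ x′ a
    own a = w-unique rR (W-refl {rad q})

  -- The lower end of an edge is weakly 1-reachable from the upper end, hence of the form
  -- `w (x a) i`, and `adjBit` records the edge.
  Sim-edge-down : ∀ {q k} {x x′ : Fin k → V} → rad q ≤ R → Sim q x x′ → ∀ a b →
                  adj G (x a) (x b) ≡ true → rk (x b) < rk (x a) → adj G (x′ a) (x′ b) ≡ true
  Sim-edge-down {q} {x = x} {x′} rR s a b e lt =
    subst (λ v → adj G (x′ a) v ≡ true) at′ (Base.adj-to (Sim.bases s a) i
      (subst (λ v → adj G (x a) v ≡ true) (≡sym at) e))
    where
    i = c (x b)
    wab : W (rad q) (x a) (x b)
    wab = W-mono (radius-pos Mb q) (W-edge e lt)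
    at : w (x a) i ≡ x b
    at = w-unique rR wab refl
    own : w (x b) i ≡ x b
    own = w-unique rR (W-refl {rad q}) refl
    at′ : w (x′ a) i ≡ x′ b
    at′ = trans (Sim.to s a b i (Bd-intro rR wab refl) (Bd-intro rR (W-refl {rad q}) refl) (trans at (≡sym own)))
      (w-unique rR (W-refl {rad q}) (≡sym (Base.c-eq (Sim.bases s b))))

  Sim-edge : ∀ {q k} {x x′ : Fin k → V} → rad q ≤ R → Sim q x x′ → ∀ a b →
             adj G (x a) (x b) ≡ true → adj G (x′ a) (x′ b) ≡ true
  Sim-edge {q} {x = x} {x′} rR s a b e with <-cmp (rk (x a)) (rk (x b))
  ... | tri> _ _ gt = Sim-edge-down rR s a b e gt
  ... | tri< lt _ _ = trans (Graph.sym G (x′ a) (x′ b))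
                        (Sim-edge-down rR s b a (trans (Graph.sym G (x b) (x a)) e) lt)
  ... | tri≈ _ eq _ with () ← trans (≡sym (irr G (x a))) (subst (λ v → adj G (x a) v ≡ true) (≡sym (rk-inj eq)) e)

  -- A quantifier costs one round: the tuple grows as `q` drops, so `k + q ≤ p` persists and the
  -- tuple is shorter than the cap whenever `forth` is called.
  eval-Sim : ∀ {k} (φ : Formula kP k) q → qr φ ≤ q → rad q ≤ R → k + q ≤ p → Fin k →
             {x x′ : Fin k → V} → Sim q x x′ → eval G P φ x ≡ eval G P φ x′
  eval-Sim (edge a b) q _ rR _ _ s = bool-ext (Sim-edge rR s a b) (Sim-edge rR (Sim-sym s) a b)
  eval-Sim (equal a b) q _ rR _ _ {x} {x′} s with x a Fin.≟ x b | x′ a Fin.≟ x′ b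
  ... | yes _  | yes _  = refl
  ... | no _   | no _   = refl
  ... | yes eq | no ne  = ⊥-elim (ne (Sim-equal rR s a b eq))
  ... | no ne  | yes eq = ⊥-elim (ne (Sim-equal rR (Sim-sym s) a b eq))
  eval-Sim (pred k a) q _ rR _ _ s =
    bool-ext (Base.pred-to (Sim.bases s a) k) (Base.pred-to (≡sym (Sim.bases s a)) k)
  eval-Sim (neg φ) q le rR kq a₀ s = cong not (eval-Sim φ q le rR kq a₀ s)
  eval-Sim (conj φ ψ) q le rR kq a₀ s =
    cong₂ _∧_ (eval-Sim φ q (≤-trans (m≤m⊔n _ _) le) rR kq a₀ s)
              (eval-Sim ψ q (≤-trans (m≤n⊔m (qr φ) _) le) rR kq a₀ s)
  eval-Sim (disj φ ψ) q le rR kq a₀ s =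
    cong₂ _∨_ (eval-Sim φ q (≤-trans (m≤m⊔n _ _) le) rR kq a₀ s)
              (eval-Sim ψ q (≤-trans (m≤n⊔m (qr φ) _) le) rR kq a₀ s)
  eval-Sim {k} (ex φ) (suc q) (s≤s le) rR kq a₀ {x} {x′} s = anyFin-matching _ _
    (λ y → let (y′ , s′) = forth a₀ k<p s y in y′ , eval-Sim φ q le r≤R skq zero s′)
    (λ y′ → let (y , s′) = forth a₀ k<p (Sim-sym s) y′ in y , eval-Sim φ q le r≤R skq zero (Sim-sym s′))
    where
    open Step q rR
    skq : suc k + q ≤ p
    skq = subst (_≤ p) (+-suc k q) kq
    k<p : k < p
    k<p = ≤-trans (m≤m+n (suc k) q) skq
  eval-Sim {k} (all φ) (suc q) (s≤s le) rR kq a₀ {x} {x′} s =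
    trans (allFin-anyFin (λ y → eval G P φ (extend y x)))
      (trans (cong not (anyFin-matching _ _
        (λ y → let (y′ , s′) = forth a₀ k<p s y in y′ , cong not (eval-Sim φ q le r≤R skq zero s′))
        (λ y′ → let (y , s′) = forth a₀ k<p (Sim-sym s) y′ in y , cong not (eval-Sim φ q le r≤R skq zero (Sim-sym s′)))))
      (≡sym (allFin-anyFin (λ y → eval G P φ (extend y x′)))))
    where
    open Step q rR
    skq : suc k + q ≤ p
    skq = subst (_≤ p) (+-suc k q) kq
    k<p : k < p
    k<p = ≤-trans (m≤m+n (suc k) q) skq

-- Subcolouring cographs

⌊⌋-true : ∀ {A : Set} (a : Dec A) → ⌊ a ⌋ ≡ true → A
⌊⌋-true (yes a) _ = a

-- Walks are shortened from the front: by induction the second vertex is the last one or adjacent to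
-- it.
P₃-free⇒cluster : ∀ (H : Graph) {N} (col : Fin (n H) → Fin N) →
  (∀ u v w → col u ≡ col v → col v ≡ col w → u ≢ w → adj H u v ≡ true → adj H v w ≡ true → adj H u w ≡ true) →
  IsSubcoloring H col
P₃-free⇒cluster H col closed i x y l walk = along walk
  where
  S : Fin (n H) → Bool
  S z = ⌊ col z ≟ᶠ i ⌋
  first : ∀ {x y l} → WalkIn H S x y l → col x ≡ i
  first {x} (here s)     = ⌊⌋-true (col x ≟ᶠ i) s
  first {x} (step s _ _) = ⌊⌋-true (col x ≟ᶠ i) s
  last : ∀ {x y l} → WalkIn H S x y l → col y ≡ i
  last {x} (here s)     = ⌊⌋-true (col x ≟ᶠ i) s
  last     (step _ _ w) = last w
  along : ∀ {x y l} → WalkIn H S x y l → x ≢ y → adj H x y ≡ true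
  along (here _) ne = ⊥-elim (ne refl)
  along {x} {y} walk@(step {z = z} s e w) ne with z ≟ᶠ y
  ... | yes refl = e
  ... | no z≢y   = closed x z y (trans (first walk) (≡sym (first w))) (trans (first w) (≡sym (last w))) ne e (along w z≢y)

-- Each class of κ induces a cograph: ℓ u v is the depth of the least common ancestor of u and v
-- in the cotree, and this depth decides adjacency.
module Cotree (H : Graph) (t : ℕ) {N D : ℕ} (κ : Fin (n H) → Fin N) (ℓ : Fin (n H) → Fin (n H) → ℕ)
  (ℓ≤D : ∀ u v → ℓ u v ≤ D)
  (ℓ-sym : ∀ {u v} → κ u ≡ κ v → ℓ u v ≡ ℓ v u)
  (ultra : ∀ {u v w a} → κ u ≡ κ v → κ v ≡ κ w → a ≤ ℓ u v → a ≤ ℓ v w → a ≤ ℓ u w)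
  (top : ∀ {u v} → κ u ≡ κ v → u ≢ v → ℓ u v < ℓ u u)
  (uniform : ∀ {u v u′ v′} → κ u ≡ κ v → κ u ≡ κ u′ → κ u ≡ κ v′ → u ≢ v → u′ ≢ v′ →
             ℓ u v ≡ ℓ u′ v′ → adj H u v ≡ adj H u′ v′)
  (noK : ¬ InducedSubgraph (K t) H) where

  private V = Fin (n H)

  -- The leaves below the ancestor of `u` at depth `a`.
  X : ℕ → V → V → Set
  X a u x = κ u ≡ κ x × a ≤ ℓ u x

  X? : ∀ a u x → Dec (X a u x)
  X? a u x = (κ u ≟ᶠ κ x) ×-dec (a ≤? ℓ u x)

  X-sym : ∀ {a u x} → X a u x → X a x u
  X-sym (k , le) = ≡sym k , ≤-trans le (≤-reflexive (ℓ-sym k))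

  X-trans : ∀ {a u x y} → X a u x → X a x y → X a u y
  X-trans (k , le) (k′ , le′) = trans k k′ , ultra k k′ le le′

  X-mono : ∀ {a b u x} → a ≤ b → X b u x → X a u x
  X-mono le (k , h) = k , ≤-trans le h

  Independent : ℕ → V → (Fin t → V) → Set
  Independent a u g = (∀ i j → g i ≡ g j → i ≡ j) × (∀ i → X a u (g i)) × (∀ i j → adj H (g i) (g j) ≡ false)

  -- Quantifying over codes in a finite type keeps the property decidable.
  Indep : ℕ → V → Set
  Indep a u = ∃ λ (k : Fin (n H ^ t)) → Independent a u (finToFun k)

  Indep? : ∀ a u → Dec (Indep a u)
  Indep? a u = any? λ k → let g = finToFun k in
    all? (λ i → all? λ j → (g i ≟ᶠ g j) →-dec (i ≟ᶠ j)) ×-dec all? (λ i → X? a u (g i)) ×-dec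
    all? (λ i → all? λ j → adj H (g i) (g j) Boolₚ.≟ false)

  Indep-intro : ∀ {a u} g → Independent a u g → Indep a u
  Indep-intro {a} {u} g (inj , inX , ind) = funToFin g ,
    (λ i j eq → inj i j (trans (≡sym (≗ i)) (trans eq (≗ j)))) ,
    (λ i → subst (X a u) (≡sym (≗ i)) (inX i)) ,
    (λ i j → trans (cong₂ (adj H) (≗ i) (≗ j)) (ind i j))
    where
    ≗ : ∀ i → finToFun (funToFin g) i ≡ g i
    ≗ = finToFun-funToFin g

  Indep-mono : ∀ {a b u} → a ≤ b → Indep b u → Indep a u
  Indep-mono le (k , inj , inX , ind) = k , inj , (λ i → X-mono le (inX i)) , ind

  -- Leaves below the children containing `u` and `v` meet at depth exactly `ℓ u v`, so `uniform`
  -- joins the two independent sets completely.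
  join⇒⊥ : ∀ {u v} → κ u ≡ κ v → u ≢ v → adj H u v ≡ true → Indep (suc (ℓ u v)) u → Indep (suc (ℓ u v)) v → ⊥
  join⇒⊥ {u} {v} k u≢v e (k₁ , inj₁′ , in₁ , ind₁) (k₂ , inj₂′ , in₂ , ind₂) = noK (h , h-inj , h-adj)
    where
    p = ℓ u v
    g₁ = finToFun k₁
    g₂ = finToFun k₂
    apart : ∀ {a b} → X (suc p) u a → X (suc p) v b → ¬ X (suc p) a b
    apart xa xb xab = 1+n≰n (proj₂ (X-trans xa (X-trans xab (X-sym xb))))
    cross : ∀ {a b} → X (suc p) u a → X (suc p) v b → adj H a b ≡ true
    cross {a} {b} xa xb = trans (≡sym (uniform k (proj₁ xa) (trans k (proj₁ xb)) u≢v a≢b p≡)) e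
      where
      a≢b : a ≢ b
      a≢b refl = 1+n≰n (proj₂ (X-trans xa (X-sym xb)))
      xab : X p a b
      xab = X-trans (X-sym (X-mono (n≤1+n p) xa)) (X-trans (k , ≤-refl) (X-mono (n≤1+n p) xb))
      p≡ : ℓ u v ≡ ℓ a b
      p≡ = ≤-antisym (proj₂ xab) (≮⇒≥ λ lt → apart xa xb (proj₁ xab , lt))
    shift : ∀ {x : Fin (t + t)} → ¬ toℕ x < t → toℕ x ∸ t < t
    shift {x} ge = +-cancelˡ-< t _ _ (subst (_< t + t) (≡sym (m+[n∸m]≡n (≮⇒≥ ge))) (toℕ<n x))
    h : Fin (t + t) → V
    h x with toℕ x <? t
    ... | yes lt = g₁ (fromℕ< lt)
    ... | no ge  = g₂ (fromℕ< (shift ge))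
    h-inj : Injective _≡_ _≡_ h
    h-inj {x} {y} eq with toℕ x <? t | toℕ y <? t
    ... | yes a | yes b = toℕ-injective (fromℕ<-injective _ _ a b (inj₁′ _ _ eq))
    ... | no a  | no b  = toℕ-injective (∸-cancelʳ-≡ (≮⇒≥ a) (≮⇒≥ b)
                            (fromℕ<-injective _ _ (shift a) (shift b) (inj₂′ _ _ eq)))
    ... | yes a | no b  = ⊥-elim (1+n≰n (proj₂ (X-trans (in₁ (fromℕ< a)) (X-sym (subst (X (suc p) v) (≡sym eq) (in₂ (fromℕ< (shift b))))))))
    ... | no a  | yes b = ⊥-elim (1+n≰n (proj₂ (X-trans (in₁ (fromℕ< b)) (X-sym (subst (X (suc p) v) eq (in₂ (fromℕ< (shift a))))))))
    h-adj : ∀ x y → side {t} x xor side {t} y ≡ adj H (h x) (h y)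
    h-adj x y with toℕ x <? t | toℕ y <? t
    ... | yes a | yes b = ≡sym (ind₁ _ _)
    ... | no a  | no b  = ≡sym (ind₂ _ _)
    ... | yes a | no b  = ≡sym (cross (in₁ _) (in₂ _))
    ... | no a  | yes b = ≡sym (trans (Graph.sym H _ _) (cross (in₁ _) (in₂ _)))

  Rep : ℕ → V → Set
  Rep a x = ∀ y → X a x y → toℕ x ≤ toℕ y

  -- the representatives of the (a+1)-classes inside the a-class of u that come before the (a+1)-class of u
  Before : ℕ → V → V → Set
  Before a u x = Rep (suc a) x × X a u x × (∀ y → X (suc a) u y → toℕ x < toℕ y)

  Before? : ∀ a u x → Dec (Before a u x)
  Before? a u x = all? (λ y → X? (suc a) x y →-dec (toℕ x ≤? toℕ y)) ×-dec X? a u x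
                  ×-dec all? (λ y → X? (suc a) u y →-dec (toℕ x <? toℕ y))

  -- Distinct representatives meet at depth exactly `ℓ u w`, where leaves are nonadjacent, so `t` of
  -- them would be an independent set.
  before-few : ∀ {u w} → κ u ≡ κ w → u ≢ w → adj H u w ≡ false → ¬ Indep (ℓ u w) u → # (Before? (ℓ u w) u) < t
  before-few {u} {w} k u≢w e ¬indep = ≰⇒> λ le → ¬indep (Indep-intro (g le) (g-inj le , g-X le , g-ind le))
    where
    a = ℓ u w
    B? = Before? a u
    g : t ≤ # B? → Fin t → V
    g le i = enum B? (inject≤ i le)
    g-inj : ∀ le i j → g le i ≡ g le j → i ≡ j
    g-inj le i j eq = inject≤-injective le le i j (enum-injective B? eq)
    g-X : ∀ le i → X a u (g le i)
    g-X le i = proj₁ (proj₂ (enum-∈ B? (inject≤ i le)))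
    g-ind : ∀ le i j → adj H (g le i) (g le j) ≡ false
    g-ind le i j with g le i ≟ᶠ g le j
    ... | yes eq = trans (cong (adj H (g le i)) (≡sym eq)) (irr H (g le i))
    ... | no ne  = trans (≡sym (uniform k (proj₁ (g-X le i)) (proj₁ (g-X le j)) u≢w ne
                     (≤-antisym (proj₂ xij) (≮⇒≥ λ lt → ne (same (proj₁ xij , lt)))))) e
      where
      xij : X a (g le i) (g le j)
      xij = X-trans (X-sym (g-X le i)) (g-X le j)
      same : X (suc a) (g le i) (g le j) → g le i ≡ g le j
      same x = toℕ-injective (≤-antisym (proj₁ (enum-∈ B? (inject≤ i le)) _ x)
                                        (proj₁ (enum-∈ B? (inject≤ j le)) _ (X-sym x)))

  -- The child classes of `u` and `w` have different least elements. The smaller one is counted for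
  -- the other class but not for its own, and whatever precedes its class precedes the other too.
  -- The smaller count is below the cap.
  before-differ : ∀ {u w} → κ u ≡ κ w → u ≢ w → adj H u w ≡ false →
    ¬ Indep (ℓ u w) u → ¬ Indep (ℓ u w) w → cap t (# (Before? (ℓ u w) u)) ≢ cap t (# (Before? (ℓ u w) w))
  before-differ {u} {w} k u≢w e ¬iu ¬iw eq = compare (<-cmp (toℕ (proj₁ mu)) (toℕ (proj₁ mw)))
    where
    a = ℓ u w
    mu = argmin toℕ (X? (suc a) u) {u} (refl , top k u≢w)
    mw = argmin toℕ (X? (suc a) w) {w} (refl , ≤-trans (s≤s (≤-reflexive (ℓ-sym k))) (top (≡sym k) (u≢w ∘ ≡sym)))
    Least : V → V → Set
    Least u r = X (suc a) u r × (∀ y → X (suc a) u y → toℕ r ≤ toℕ y)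
    fewer : ∀ {u w ru rw} → X a u w → Least u ru → Least w rw → toℕ ru < toℕ rw → # (Before? a u) < # (Before? a w)
    fewer {u} {w} {ru} {rw} x (xu , lu) (xw , lw) lt = #-mono-< (Before? a u) (Before? a w)
      (λ z (rep , xz , bz) → rep , X-trans (X-sym x) xz , λ y xy → <-trans (bz ru xu) (<-≤-trans lt (lw y xy)))
      ru ((λ y xy → lu y (X-trans xu xy)) , X-trans (X-sym x) (X-mono (n≤1+n a) xu) , λ y xy → <-≤-trans lt (lw y xy))
      (λ (_ , _ , b) → <-irrefl refl (b ru xu))
    compare : Tri (toℕ (proj₁ mu) < toℕ (proj₁ mw)) (toℕ (proj₁ mu) ≡ toℕ (proj₁ mw)) (toℕ (proj₁ mw) < toℕ (proj₁ mu)) → ⊥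
    compare (tri< lt _ _) = <⇒≱ (fewer (k , ≤-refl) (proj₂ mu) (proj₂ mw) lt)
      (cap-reflects-≤ t (≡sym eq) (before-few k u≢w e ¬iu))
    compare (tri> _ _ gt) = <⇒≱ (fewer (X-sym (k , ≤-refl)) (proj₂ mw) (proj₂ mu) gt)
      (cap-reflects-≤ t eq few-w)
      where
      few-w : # (Before? a w) < t
      few-w = subst (λ b → # (Before? b w) < t) (≡sym (ℓ-sym k))
        (before-few (≡sym k) (u≢w ∘ ≡sym) (trans (Graph.sym H w u) e) (subst (λ b → ¬ Indep b w) (ℓ-sym k) ¬iw))
    compare (tri≈ _ same _) = 1+n≰n (proj₂ (X-trans (proj₁ (proj₂ mu))
      (X-sym (subst (X (suc a) w) (≡sym (toℕ-injective same)) (proj₁ (proj₂ mw))))))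

  -- The range ends at depth `D + 1` because `closed` looks at the children of a node whose depth
  -- may be `D`.
  indepBit : V → Fin (suc (suc D)) → Fin 2
  indepBit u a = bit (Indep? (toℕ a) u)

  position : V → Fin (suc D) → Fin (suc t)
  position u a = cap t (# (Before? (toℕ a) u))

  colour : V → Fin (N * (2 ^ suc (suc D) * suc t ^ suc D))
  colour = κ ⊗ (table indepBit ⊗ table position)

  module _ {u v : V} (eq : colour u ≡ colour v) where
    private
      e₁ = ⊗-injective κ (table indepBit ⊗ table position) {u} {v} eq
      e₂ = ⊗-injective (table indepBit) (table position) {u} {v} (proj₂ e₁)

    colour-κ : κ u ≡ κ v
    colour-κ = proj₁ e₁

    colour-indep : ∀ {a} → a ≤ suc D → Indep a u → Indep a v
    colour-indep {a} le ind = subst (λ b → Indep b v) a≡ (bit-transfer (Indep? (toℕ af) u) (Indep? (toℕ af) v)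
      (table-at indepBit {u} {v} (proj₁ e₂) af) (subst (λ b → Indep b u) (≡sym a≡) ind))
      where
      af = fromℕ< (s≤s le)
      a≡ : toℕ af ≡ a
      a≡ = toℕ-fromℕ< (s≤s le)

    colour-position : ∀ {a} → a ≤ D → cap t (# (Before? a u)) ≡ cap t (# (Before? a v))
    colour-position {a} le = subst (λ b → cap t (# (Before? b u)) ≡ cap t (# (Before? b v))) (toℕ-fromℕ< (s≤s le))
      (table-at position {u} {v} (proj₂ e₂) (fromℕ< (s≤s le)))

  -- Unless `u` and `w` meet strictly below a join node where both meet `v`, they meet at the depth
  -- of one of the edges. In the remaining case equal bits and `join⇒⊥` exclude independent `t`-sets
  -- below the join, and nonadjacency would give `u` and `w` different positions.
  closed : ∀ u v w → colour u ≡ colour v → colour v ≡ colour w → u ≢ w →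
           adj H u v ≡ true → adj H v w ≡ true → adj H u w ≡ true
  closed u v w cuv cvw u≢w euv evw = cases (<-cmp (ℓ u v) (ℓ v w))
    where
    kuv = colour-κ cuv
    kvw = colour-κ cvw
    kuw = trans kuv kvw
    cuw = trans cuv cvw
    distinct : ∀ {a b} → adj H a b ≡ true → a ≢ b
    distinct {a} e refl with () ← trans (≡sym (irr H a)) e
    like-uv : ℓ u w ≡ ℓ u v → adj H u w ≡ true
    like-uv eq = trans (uniform kuw refl kuv u≢w (distinct euv) eq) euv
    ¬not-true : ∀ {b} → b ≢ true → b ≡ false
    ¬not-true {true}  ne = ⊥-elim (ne refl)
    ¬not-true {false} _  = refl
    cases : Tri (ℓ u v < ℓ v w) (ℓ u v ≡ ℓ v w) (ℓ v w < ℓ u v) → adj H u w ≡ true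
    cases (tri< lt _ _) = like-uv (≤-antisym
      (≮⇒≥ λ lt′ → 1+n≰n (proj₂ (X-trans (kuw , lt′) (X-sym (kvw , lt)))))
      (ultra kuv kvw ≤-refl (<⇒≤ lt)))
    cases (tri> _ _ gt) = trans (uniform kuw kuv kuw u≢w (distinct evw) (≤-antisym
      (≮⇒≥ λ lt′ → 1+n≰n (proj₂ (X-trans (X-sym (kuv , gt)) (kuw , lt′))))
      (ultra kuv kvw (<⇒≤ gt) ≤-refl))) evw
    cases (tri≈ _ eq _) with m≤n⇒m<n∨m≡n (ultra kuv kvw ≤-refl (≤-reflexive eq))
    ... | inj₂ eq′ = like-uv (≡sym eq′)
    ... | inj₁ lt  = decidable-stable (adj H u w Boolₚ.≟ true) λ ne →
        before-differ kuw u≢w (¬not-true ne) (¬indep ∘ Indep-mono lt)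
          (λ iw → ¬indep (colour-indep (≡sym cuw) (s≤s (ℓ≤D u v)) (Indep-mono lt iw)))
          (colour-position cuw (ℓ≤D u w))
      where
      ¬indep : ¬ Indep (suc (ℓ u v)) u
      ¬indep iu = join⇒⊥ kuv (distinct euv) euv iu (colour-indep cuv (s≤s (ℓ≤D u v)) iu)

  subcolouring : IsSubcoloring H colour
  subcolouring = P₃-free⇒cluster H colour closed

-- The tree structure on vertices of one type

module Classes {G : Graph} {m R : ℕ} {Mb : ℕ → ℕ} (S : System G m R Mb)
               {kP : ℕ} (P : Fin kP → Fin (n G) → Bool) (p Q : ℕ) (R≥ : radius Mb Q + radius Mb Q ≤ R) where

  open System S
  open Types S P p

  private
    V = Fin (n G)
    r = rad Q
    r≤R : r ≤ R
    r≤R = ≤-trans (m≤m+n r r) R≥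

  I : V → V → Fin m → Set
  I u v i = Bd r u i × w u i ≡ w v i

  I? : ∀ u v i → Dec (I u v i)
  I? u v i = Bd? r u i ×-dec (w u i ≟ᶠ w v i)

  depth : V → V → ℕ
  depth u v = # (I? u v)

  depth≤m : ∀ u v → depth u v ≤ m
  depth≤m u v = atMost⇒#≤ (I? u v) ((λ i _ → i) , λ _ _ eq → eq)

  I-sym : ∀ {u v i} → χ Q u ≡ χ Q v → I u v i → I v u i
  I-sym eq (bd , e) = Base.Bd-to (χ⇒base Q eq) r≤R bd , ≡sym e

  I-trans : ∀ {u v x i} → I u v i → I v x i → I u x i
  I-trans (bd , e) (_ , e′) = bd , trans e e′

  -- Through `u` and through `v`, the common vertex `w u i` weakly reaches both `w u j` and `w v j`.
  -- They have the same colour, so the rainbow property makes them equal.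
  I-down : ∀ {u v i j} → χ Q u ≡ χ Q v → I u v i → Bd r u j → rk (w u j) ≤ rk (w u i) → I u v j
  I-down {u} {v} {i} {j} eq (bdi , e) bdj le = bdj , c-inj
    (W-mono R≥ (W-fork le (proj₁ bdi) (proj₁ bdj)))
    (subst (λ z → W R z (w v j)) (≡sym e) (W-mono R≥ (W-fork le′ (proj₁ bdi′) (proj₁ bdj′))))
    (trans (proj₂ bdj) (≡sym (proj₂ bdj′)))
    where
    b = χ⇒base Q eq
    bdi′ = Base.Bd-to b r≤R bdi
    bdj′ = Base.Bd-to b r≤R bdj
    le′ : rk (w v j) ≤ rk (w v i)
    le′ = ≮⇒≥ λ lt → <⇒≱ (Base.rank-to (χ⇒base Q (≡sym eq)) i j lt) le

  -- Both are initial segments of the same colours, in the rank order prescribed by the common type.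
  I-nested : ∀ {u v u′ v′} → χ Q u ≡ χ Q v → χ Q u′ ≡ χ Q v′ → χ Q u ≡ χ Q u′ →
             (∀ i → I u v i → I u′ v′ i) ⊎ (∀ i → I u′ v′ i → I u v i)
  I-nested {u} {v} {u′} {v′} k k′ ku with any? (λ i → I? u v i ×-dec ¬? (I? u′ v′ i))
  ... | no ¬e = inj₁ λ i p → decidable-stable (I? u′ v′ i) λ ¬p → ¬e (i , p , ¬p)
  ... | yes (i , p , ¬p) = inj₂ λ j q → I-down k p (Base.Bd-to (χ⇒base Q (≡sym ku)) r≤R (proj₁ q))
      (≮⇒≥ λ lt → ¬p (I-down k′ q (Base.Bd-to (χ⇒base Q ku) r≤R (proj₁ p))
        (<⇒≤ (Base.rank-to (χ⇒base Q ku) i j lt))))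

  I-of-depth : ∀ {u v u′ v′} → χ Q u ≡ χ Q v → χ Q u′ ≡ χ Q v′ → χ Q u ≡ χ Q u′ →
               depth u v ≡ depth u′ v′ → ∀ i → I u v i → I u′ v′ i
  I-of-depth {u} {v} {u′} {v′} k k′ ku eq i p with I-nested k k′ ku
  ... | inj₁ sub = sub i p
  ... | inj₂ sub = decidable-stable (I? u′ v′ i) λ ¬p →
        <⇒≢ (#-mono-< (I? u′ v′) (I? u v) sub i p ¬p) (≡sym eq)

  depth-sym : ∀ {u v} → χ Q u ≡ χ Q v → depth u v ≡ depth v u
  depth-sym {u} {v} k = #-cong (I? u v) (I? v u) (λ _ → I-sym k) (λ _ → I-sym (≡sym k))

  depth-ultra : ∀ {u v x a} → χ Q u ≡ χ Q v → χ Q v ≡ χ Q x → a ≤ depth u v → a ≤ depth v x → a ≤ depth u x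
  depth-ultra {u} {v} {x} k k′ le le′ with I-nested k k′ k
  ... | inj₁ sub = ≤-trans le (#-mono (I? u v) (I? u x) λ i p → I-trans p (sub i p))
  ... | inj₂ sub = ≤-trans le′ (#-mono (I? v x) (I? u x) λ i p → I-trans (sub i p) p)

  -- Vertices of one type share their colour, and at that colour each sees itself.
  depth-top : ∀ {u v} → χ Q u ≡ χ Q v → u ≢ v → depth u v < depth u u
  depth-top {u} {v} k u≢v = #-mono-< (I? u v) (I? u u) (λ _ p → proj₁ p , refl) (c u)
    (Bd-intro r≤R W-refl refl , refl)
    (λ (_ , e) → u≢v (trans (≡sym (w-unique r≤R (W-refl {r}) refl))
                      (trans e (w-unique r≤R (W-refl {r}) (≡sym (Base.c-eq (χ⇒base Q k)))))))

  depth-Sim : ∀ {u v u′ v′} → χ Q u ≡ χ Q v → χ Q u ≡ χ Q u′ → χ Q u ≡ χ Q v′ →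
              depth u v ≡ depth u′ v′ → Sim Q (pair u v) (pair u′ v′)
  depth-Sim {u} {v} {u′} {v′} k ku kv eq = record
    { types = λ { zero → ku ; (suc zero) → trans (≡sym k) kv }
    ; to = half (I-of-depth k k′ ku eq) ; from = half (I-of-depth k′ k (≡sym ku) (≡sym eq)) }
    where
    k′ = trans (≡sym ku) kv
    half : ∀ {u v u′ v′} → (∀ i → I u v i → I u′ v′ i) → ∀ a b i → Bd r (pair u v a) i → Bd r (pair u v b) i →
           w (pair u v a) i ≡ w (pair u v b) i → w (pair u′ v′ a) i ≡ w (pair u′ v′ b) i
    half f zero       zero       i _  _   _ = refl
    half f zero       (suc zero) i bd _   e = proj₂ (f i (bd , e))
    half f (suc zero) zero       i _  bd  e = ≡sym (proj₂ (f i (bd , ≡sym e)))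
    half f (suc zero) (suc zero) i _  _   _ = refl

-- Constants and conclusion

interpret-adj : ∀ T G P {a b a′ b′} → a ≢ b → a′ ≢ b′ →
  eval G P (φ T) (pair a b) ≡ eval G P (φ T) (pair a′ b′) → eval G P (φ T) (pair b a) ≡ eval G P (φ T) (pair b′ a′) →
  adj (interpret T G P) a b ≡ adj (interpret T G P) a′ b′
interpret-adj T G P {a} {b} {a′} {b′} ne ne′ e₁ e₂ with a Fin.≟ b | a′ Fin.≟ b′
... | yes eq | _      = ⊥-elim (ne eq)
... | no _   | yes eq = ⊥-elim (ne′ eq)
... | no _   | no _   = cong₂ _∧_ e₁ e₂

inhabited? : ∀ N → Fin N ⊎ ¬ Fin N
inhabited? zero    = inj₂ λ ()
inhabited? (suc N) = inj₁ zero

module Constants (t : ℕ) (f : ℕ → ℕ) (T : Transduction) where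
  open Bounds f

  Mb : ℕ → ℕ
  Mb l = suc (weakBound l)

  Q R m p colours : ℕ
  Q = qr (φ T)
  -- Twice the radius leaves room for the forks in `I-down`; `p` allows for two free variables and
  -- `Q` nested quantifiers.
  R = radius Mb Q + radius Mb Q
  m = suc (suc (weakBound (R + R)))
  p = 2 + Q
  colours = typeSize m R (k T) p Q * (2 ^ suc (suc m) * suc t ^ suc m)

transduction-subcolouring : ∀ t f T G → (∀ d H → DepthMinor d H G → degreeSum H ≤ f d * n H) →
  ∀ H → TransducibleVia T G H → ¬ InducedSubgraph (K t) H →
  Σ (Fin (n H) → Fin (Constants.colours t f T)) λ col → IsSubcoloring H col
transduction-subcolouring t f T G sparse H (P , h , h-inj , h-adj) noK with inhabited? (n G)
... | inj₂ ¬v = (λ u → ⊥-elim (¬v (h u))) , λ _ x → ⊥-elim (¬v (h x))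
... | inj₁ v₀ = colour , subcolouring
  where
  open Constants t f T
  S : System G m R Mb
  S = system G f sparse v₀ R
  open Types S P p using (χ; eval-Sim; Sim)
  open Classes S P p Q ≤-refl
  evals : ∀ {u v u′ v′} → Sim Q (pair u v) (pair u′ v′) → eval G P (φ T) (pair u v) ≡ eval G P (φ T) (pair u′ v′)
  evals = eval-Sim (φ T) Q ≤-refl (m≤m+n (radius Mb Q) _) ≤-refl zero
  uniform : ∀ {u v u′ v′} → χ Q (h u) ≡ χ Q (h v) → χ Q (h u) ≡ χ Q (h u′) → χ Q (h u) ≡ χ Q (h v′) →
            u ≢ v → u′ ≢ v′ → depth (h u) (h v) ≡ depth (h u′) (h v′) → adj H u v ≡ adj H u′ v′
  uniform {u} {v} {u′} {v′} k ku kv ne ne′ eq = trans (h-adj u v) (trans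
    (interpret-adj T G P (ne ∘ h-inj) (ne′ ∘ h-inj) (evals (depth-Sim k ku kv eq))
      -- `interpret` evaluates the formula in both orders, so the reversed pairs are compared as
      -- well.
      (evals (depth-Sim (≡sym k) (trans (≡sym k) kv) (trans (≡sym k) ku)
        (trans (≡sym (depth-sym k)) (trans eq (depth-sym (trans (≡sym ku) kv)))))))
    (≡sym (h-adj u′ v′)))
  open Cotree H t (χ Q ∘ h) (λ u v → depth (h u) (h v)) (λ u v → depth≤m (h u) (h v))
    depth-sym depth-ultra (λ k ne → depth-top k (ne ∘ h-inj)) uniform noK using (colour; subcolouring)

theorem3p4 : (t : ℕ) (𝒟 : GraphClass) →
    StructurallyBoundedExpansion 𝒟 →
    (∀ G → 𝒟 G → ¬ InducedSubgraph (K t) G) →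
    BoundedSubchromatic 𝒟
theorem3p4 t 𝒟 (𝒞 , (f , sparse) , T , transduce) noK = Constants.colours t f T , λ H H∈𝒟 →
  let (G , G∈𝒞 , via) = transduce H H∈𝒟
  in transduction-subcolouring t f T G (λ d → sparse d G G∈𝒞) H via (noK H H∈𝒟)
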